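{- Let $p$ be a prime number and let $\alpha\in\mathbb{Q}$. Then the sequence $\{\alpha_n\}$ generated from $\alpha_0=\alpha$ by the algorithm described in the context is finite (i.e. the algorithm halts).
   Context: Let $p$ be a prime and $K$ a field with field embeddings $\sigma_\infty:K\to\mathbb{R}$ and $\sigma_p:K\to\mathbb{Q}_p$ (so $\mathbb{Q}\subset K$). For $\alpha\in K$ write $\alpha_\infty=\sigma_\infty(\alpha)$ and $\alpha_{\langle p\rangle}=\sigma_p(\alpha)$. Every $u\in\mathbb{Q}_p$ is uniquely $u=\sum_{n\in\mathbb{Z}}c_np^n$ with $c_n\in\{0,\dots,p-1\}$ and $c_n=0$ for $n<v_p(u)$; put $\lfloor u\rfloor_p=\sum_{n\le 0}c_np^n\in\mathbb{Z}[1/p]$. For $\alpha\in K$ let $b^{(0)}(\alpha)=mp+\lfloor\alpha_{\langle p\rangle}\rfloor_p$, where $m$ is the smallest among the integers $i$ minimizing $|\alpha_\infty-ip-\lfloor\alpha_{\langle p\rangle}\rfloor_p|$; let $b^{(1)}(\alpha)=m'+\lfloor\alpha_{\langle p\rangle}\rfloor_p$, where $m'$ is the smallest among the integers $i$ minimizing $|\alpha_\infty-i-\lfloor\alpha_{\langle p\rangle}\rfloor_p|$. For $\epsilon\in\{0,1\}$ let $F_{p,\epsilon}(\alpha)=\frac{1}{\alpha-b^{(\epsilon)}(\alpha)}$, undefined if $\alpha=b^{(\epsilon)}(\alpha)$. Algorithm: $\alpha_0=\alpha$; $\alpha_{n+1}=F_{p,0}(\alpha_n)$ if $n$ is even and $\alpha_{n+1}=F_{p,1}(\alpha_n)$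 if $n$ is odd. The algorithm halts (and $\alpha_{n+1},\alpha_{n+2},\dots$ are not defined) if the required value $F_{p,0}(\alpha_n)$ or $F_{p,1}(\alpha_n)$ is undefined. -}

module Defs where

open import Algebra.Apartness.Bundles using (HeytingField; HeytingCommutativeRing)
open import Algebra.Bundles using (CommutativeRing)
open import Algebra.Bundles.Raw using (RawRing)
open import Algebra.Morphism.Structures using (IsRingMonomorphism)
open import Data.Fin.Base using (Fin; toℕ)
open import Data.Integer.Base as ℤ using (ℤ; +_; -[1+_])
open import Data.Nat.Base as ℕ using (ℕ; zero; suc; NonZero; parity)
open import Data.Nat.Divisibility using (_∣?_; divides)
open import Data.Nat.Primality using (Prime; prime⇒nonZero)
open import Data.Nat.Properties using (m^n≢0)
open import Data.Parity.Base using (Parity; 0ℙ; 1ℙ)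
open import Data.Product.Base using (_×_; ∃-syntax; Σ-syntax)
open import Data.Rational.Base as ℚ using (ℚ; 0ℚ; 1ℚ; ↥_; ↧ₙ_)
open import Data.Rational.Properties using (_≟_)
open import Level using (_⊔_; 0ℓ)
open import Relation.Binary.PropositionalEquality.Core using (_≡_)
open import Relation.Nullary.Decidable.Core using (yes; no)

Seq : Set
Seq = ℕ → ℚ

-- The completion of ℚ for an absolute value is the ring of Cauchy sequences
-- modulo null sequences: ℝ for the usual absolute value, ℚ_p for the p-adic one.

module Completion (abs : ℚ → ℚ) where

  Cauchy : Seq → Set
  Cauchy u = ∀ ε → 0ℚ ℚ.< ε →
    ∃[ N ] ∀ m n → N ℕ.≤ m → N ℕ.≤ n → abs (u m ℚ.- u n) ℚ.< ε

  infix 4 _≃_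

  _≃_ : Seq → Seq → Set
  u ≃ v = ∀ ε → 0ℚ ℚ.< ε → ∃[ N ] ∀ n → N ℕ.≤ n → abs (u n ℚ.- v n) ℚ.< ε

  -- Operations are pointwise on all sequences; the completion is the subring
  -- cut out by Cauchy.
  seqRing : RawRing 0ℓ 0ℓ
  seqRing = record
    { Carrier = Seq
    ; _≈_     = _≃_
    ; _+_     = λ u v n → u n ℚ.+ v n
    ; _*_     = λ u v n → u n ℚ.* v n
    ; -_      = λ u n → ℚ.- u n
    ; 0#      = λ _ → 0ℚ
    ; 1#      = λ _ → 1ℚ
    }

-- The order of ℝ on representing Cauchy sequences.

infix 4 _≤ᴿ_

_≤ᴿ_ : Seq → Seq → Set
u ≤ᴿ v = ∀ ε → 0ℚ ℚ.< ε → ∃[ N ] ∀ n → N ℕ.≤ n → u n ℚ.≤ v n ℚ.+ ε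

-- The exponent of p in n, for n > 0 and p > 1; the first argument of `go` is
-- fuel, of which n units suffice since p ^ k ∣ n forces k < n.

multiplicity : ℕ → ℕ → ℕ
multiplicity p n = go n n
  where
  go : ℕ → ℕ → ℕ
  go zero       n = 0
  go (suc fuel) n with p ∣? n
  ... | yes (divides q _) = suc (go fuel q)
  ... | no  _             = 0

∑< : ℕ → (ℕ → ℚ) → ℚ
∑< zero    f = 0ℚ
∑< (suc n) f = ∑< n f ℚ.+ f n

module PAdic (p : ℕ) (p-prime : Prime p) where

  private instance
    p≢0 : NonZero p
    p≢0 = prime⇒nonZero p-prime

  infix 8 p^_

  p^_ : ℤ → ℚ
  p^ (+ n)    = + (p ℕ.^ n) ℚ./ 1
  p^ -[1+ n ] = (+ 1 ℚ./ (p ℕ.^ suc n)) {{m^n≢0 p (suc n)}}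

  valuation : ℚ → ℤ
  valuation q = + multiplicity p ℤ.∣ ↥ q ∣ ℤ.- + multiplicity p (↧ₙ q)

  ∣_∣ₚ : ℚ → ℚ
  ∣ q ∣ₚ with q ≟ 0ℚ
  ... | yes _ = 0ℚ
  ... | no  _ = p^ (ℤ.- valuation q)

  open Completion ∣_∣ₚ public

  -- partialSum c d N = Σ_{-d ≤ n ≤ N} cₙ pⁿ
  partialSum : (ℤ → Fin p) → ℕ → ℕ → ℚ
  partialSum c d N = ∑< (d ℕ.+ suc N) λ j →
    let n = + j ℤ.- + d in (+ toℕ (c n) ℚ./ 1) ℚ.* p^ n

  -- u = Σ_{n ∈ ℤ} cₙ pⁿ in ℚ_p.  Any bound -d below which the digits vanish is
  -- allowed; such an expansion is unique, and its digits vanish below v_p(u).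
  record Expansion (u : Seq) : Set where
    field
      digit     : ℤ → Fin p
      d         : ℕ
      vanishing : ∀ n → n ℤ.< ℤ.- + d → toℕ (digit n) ≡ 0
      converges : u ≃ partialSum digit d

    -- ⌊u⌋_p = Σ_{n ≤ 0} cₙ pⁿ
    floor : ℚ
    floor = partialSum digit d 0

ringOf : ∀ {c ℓ₁ ℓ₂} → HeytingField c ℓ₁ ℓ₂ → CommutativeRing c ℓ₁
ringOf K = HeytingCommutativeRing.commutativeRing (HeytingField.heytingCommutativeRing K)

-- A field embedding of K into the completion of ℚ for abs.

record Embedding {c ℓ₁ ℓ₂} (K : HeytingField c ℓ₁ ℓ₂) (abs : ℚ → ℚ) : Set (c ⊔ ℓ₁) where
  open Completion abs
  field
    ⟦_⟧                : HeytingField.Carrier K → Seq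
    cauchy             : ∀ x → Cauchy ⟦ x ⟧
    isRingMonomorphism : IsRingMonomorphism (CommutativeRing.rawRing (ringOf K)) seqRing ⟦_⟧

-- ι is the inclusion ℚ ⊂ K: a ring homomorphism, hence unique.

module Algorithm
  {c ℓ₁ ℓ₂} (p : ℕ) (p-prime : Prime p) (K : HeytingField c ℓ₁ ℓ₂)
  (σ∞ : Embedding K ℚ.∣_∣) (σₚ : Embedding K (PAdic.∣_∣ₚ p p-prime))
  (ι : ℚ → HeytingField.Carrier K)
  where

  open PAdic p p-prime using (Expansion)
  open CommutativeRing (ringOf K)
  private
    module σ∞ = Embedding σ∞
    module σₚ = Embedding σₚ

  scale : Parity → ℤ
  scale 0ℙ = + p
  scale 1ℙ = + 1

  candidate : Parity → ℚ → ℤ → ℚ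
  candidate ε f i = ((i ℤ.* scale ε) ℚ./ 1) ℚ.+ f

  distance : Carrier → ℚ → Seq
  distance x q n = ℚ.∣ σ∞.⟦ x ⟧ n ℚ.- q ∣

  Minimizer : Parity → Carrier → ℚ → ℤ → Set
  Minimizer ε x f i =
    ∀ j → distance x (candidate ε f i) ≤ᴿ distance x (candidate ε f j)

  LeastMinimizer : Parity → Carrier → ℚ → ℤ → Set
  LeastMinimizer ε x f m = Minimizer ε x f m × (∀ i → Minimizer ε x f i → m ℤ.≤ i)

  -- b⁽ᵉ⁾(x) = b
  _[_]↦b_ : Parity → Carrier → ℚ → Set
  ε [ x ]↦b b = Σ[ e ∈ Expansion σₚ.⟦ x ⟧ ] ∃[ m ]
    LeastMinimizer ε x (Expansion.floor e) m × b ≡ candidate ε (Expansion.floor e) m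

  -- F_{p,ε}(x) is defined and equals y
  _[_]↦F_ : Parity → Carrier → Carrier → Set ℓ₁
  ε [ x ]↦F y = ∃[ b ] (ε [ x ]↦b b) × y * (x - ι b) ≈ 1#

  -- F_{p,ε}(x) is undefined
  FUndefined : Parity → Carrier → Set ℓ₁
  FUndefined ε x = ∃[ b ] (ε [ x ]↦b b) × x ≈ ι b

  -- Term α n x: αₙ is defined and equals x, where α₀ = α
  data Term (α : Carrier) : ℕ → Carrier → Set (c ⊔ ℓ₁) where
    start : ∀ {x} → x ≈ α → Term α 0 x
    step  : ∀ {n x y} → Term α n x → parity n [ x ]↦F y → Term α (suc n) y

  -- The sequence is finite: some αₙ is defined and the value of F at αₙ that
  -- αₙ₊₁ requires is undefined.  Terms are unique up to ≈, because expansions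
  -- and least minimizers are.
  Halts : Carrier → Set (c ⊔ ℓ₁)
  Halts α = ∃[ n ] ∃[ x ] Term α n x × FUndefined (parity n) x

{-# OPTIONS --safe #-}
module Submission where

-- Write αₙ = A / (B pᵈ) with p ∤ B.  The p-adic floor of αₙ is congruent to αₙ
-- modulo p, so αₙ - b⁽ᵉ⁾(αₙ) = s R / B with R an integer and s = p or s = 1 the
-- spacing of the candidates for b⁽ᵉ⁾; the real minimization makes R a remainder
-- of least absolute value modulo B, so 2∣R∣ ≤ B.  Either R = 0 and the
-- algorithm halts, or αₙ₊₁ = B / (s R), whose denominator without its factors p
-- is at most ∣R∣ < B.

open import Defs
open import Algebra.Apartness.Bundles using (HeytingField)
open import Algebra.Bundles using (CommutativeRing)
import Algebra.Morphism.Construct.Composition as Composition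
open import Algebra.Morphism.Structures using (IsRingHomomorphism; module IsRingMonomorphism)
open import Data.Fin.Base using (Fin; toℕ; fromℕ<)
import Data.Fin.Properties as Fin
open import Data.Integer.Base as ℤ using (ℤ; +_; -[1+_]; _⊖_)
open import Data.Integer.Divisibility.Signed using (∣ᵤ⇒∣) renaming (module _∣_ to _∣ℤ_)
import Data.Integer.DivMod as ℤ
import Data.Integer.Properties as ℤ
open import Data.Integer.Solver using () renaming (module +-*-Solver to ℤS)
open import Data.Nat.Base as ℕ using (ℕ; zero; suc; parity)
open import Data.Nat.Coprimality using (Coprime; coprime-Bézout; recompute)
open import Data.Nat.Divisibility
  using (_∣_; _∣?_; divides; ∣-trans; m∣m*n; ∣n⇒∣m*n; _∣0; quotient≢0; quotient-<; ∣⇒≤)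
open import Data.Nat.GCD using (module Bézout)
open import Data.Nat.Induction using (Acc; acc; <-wellFounded)
open import Data.Nat.Primality
  using (Prime; prime⇒nonZero; prime⇒nonTrivial; prime⇒irreducible; euclidsLemma)
import Data.Nat.Properties as ℕ
open import Data.Nat.Solver using () renaming (module +-*-Solver to ℕS)
open import Data.Parity.Base using (Parity; 0ℙ; 1ℙ)
open import Data.Product.Base using (_×_; _,_; ∃-syntax; proj₁; proj₂)
open import Data.Rational.Base hiding (_≃_; _⊔_)
open import Data.Rational.Properties
open import Data.Rational.Solver using (module +-*-Solver)
open import Data.Rational.Unnormalised.Base as ℚᵘ using (mkℚᵘ; *≡*)
import Data.Rational.Unnormalised.Properties as ℚᵘ
open import Data.Sum.Base using (_⊎_; inj₁; inj₂; [_,_]′)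
open import Function.Base using (id)
open import Level using (_⊔_)
open import Relation.Binary.Definitions using (Transitive; tri<; tri≈; tri>)
open import Relation.Binary.PropositionalEquality
open import Relation.Nullary using (¬_; Dec; yes; no; contradiction)

open +-*-Solver using (solve; _:+_; _:*_; _:-_; :-_; _:=_; con)

-- `K` is abstract, and its elements are visible only through Cauchy sequences taken modulo null
-- sequences, from which neither digits nor nearest integers can be read off directly. The way
-- around is rigidity: a ring homomorphism from ℚ to either completion sends every rational to the
-- class of its constant sequence. Every term is therefore kept in the form `ι q`, and the floor,
-- the minimization and the test for halting become statements about ℚ and ℤ. Since `Halts` asks for
-- witnesses, an expansion and a least minimizer are constructed at each step. The descent measures
-- only the part of the denominator prime to p, because the power of p is not under control: at an
-- even step the spacing s = p puts a new factor p under the numerator B, which is prime to p.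

-- The integers inside ℚ.

⌜_⌝ : ℤ → ℚ
⌜ z ⌝ = z / 1

private
  toℚᵘ-⌜⌝ : ∀ z → toℚᵘ ⌜ z ⌝ ℚᵘ.≃ mkℚᵘ z 0
  toℚᵘ-⌜⌝ z = toℚᵘ-fromℚᵘ (mkℚᵘ z 0)

⌜⌝-+ : ∀ x y → ⌜ x ℤ.+ y ⌝ ≡ ⌜ x ⌝ + ⌜ y ⌝
⌜⌝-+ x y = toℚᵘ-injective (begin
  toℚᵘ ⌜ x ℤ.+ y ⌝               ≈⟨ toℚᵘ-⌜⌝ (x ℤ.+ y) ⟩
  mkℚᵘ (x ℤ.+ y) 0               ≈⟨ *≡* (cong (ℤ._* + 1) (cong₂ ℤ._+_ (sym (ℤ.*-identityʳ x)) (sym (ℤ.*-identityʳ y)))) ⟩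
  mkℚᵘ x 0 ℚᵘ.+ mkℚᵘ y 0         ≈⟨ ℚᵘ.+-cong (toℚᵘ-⌜⌝ x) (toℚᵘ-⌜⌝ y) ⟨
  toℚᵘ ⌜ x ⌝ ℚᵘ.+ toℚᵘ ⌜ y ⌝     ≈⟨ toℚᵘ-homo-+ ⌜ x ⌝ ⌜ y ⌝ ⟨
  toℚᵘ (⌜ x ⌝ + ⌜ y ⌝)           ∎)
  where open ℚᵘ.≃-Reasoning

⌜⌝-* : ∀ x y → ⌜ x ℤ.* y ⌝ ≡ ⌜ x ⌝ * ⌜ y ⌝
⌜⌝-* x y = toℚᵘ-injective (begin
  toℚᵘ ⌜ x ℤ.* y ⌝               ≈⟨ toℚᵘ-⌜⌝ (x ℤ.* y) ⟩
  mkℚᵘ x 0 ℚᵘ.* mkℚᵘ y 0         ≈⟨ ℚᵘ.*-cong (toℚᵘ-⌜⌝ x) (toℚᵘ-⌜⌝ y) ⟨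
  toℚᵘ ⌜ x ⌝ ℚᵘ.* toℚᵘ ⌜ y ⌝     ≈⟨ toℚᵘ-homo-* ⌜ x ⌝ ⌜ y ⌝ ⟨
  toℚᵘ (⌜ x ⌝ * ⌜ y ⌝)           ∎)
  where open ℚᵘ.≃-Reasoning

⌜⌝-ℕ* : ∀ m n → ⌜ + (m ℕ.* n) ⌝ ≡ ⌜ + m ⌝ * ⌜ + n ⌝
⌜⌝-ℕ* m n = trans (cong ⌜_⌝ (ℤ.pos-* m n)) (⌜⌝-* (+ m) (+ n))

⌜⌝-neg : ∀ x → ⌜ ℤ.- x ⌝ ≡ - ⌜ x ⌝
⌜⌝-neg x = toℚᵘ-injective (begin
  toℚᵘ ⌜ ℤ.- x ⌝      ≈⟨ toℚᵘ-⌜⌝ (ℤ.- x) ⟩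
  ℚᵘ.- mkℚᵘ x 0       ≈⟨ ℚᵘ.-‿cong (toℚᵘ-⌜⌝ x) ⟨
  ℚᵘ.- toℚᵘ ⌜ x ⌝     ≈⟨ toℚᵘ-homo‿- ⌜ x ⌝ ⟨
  toℚᵘ (- ⌜ x ⌝)      ∎)
  where open ℚᵘ.≃-Reasoning

⌜⌝-- : ∀ x y → ⌜ x ℤ.- y ⌝ ≡ ⌜ x ⌝ - ⌜ y ⌝
⌜⌝-- x y = trans (⌜⌝-+ x (ℤ.- y)) (cong (_+_ ⌜ x ⌝) (⌜⌝-neg y))

⌜⌝-∣∣ : ∀ x → ∣ ⌜ x ⌝ ∣ ≡ ⌜ + ℤ.∣ x ∣ ⌝
⌜⌝-∣∣ x = toℚᵘ-injective (begin
  toℚᵘ ∣ ⌜ x ⌝ ∣          ≈⟨ toℚᵘ-homo-∣-∣ ⌜ x ⌝ ⟩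
  ℚᵘ.∣ toℚᵘ ⌜ x ⌝ ∣       ≈⟨ ℚᵘ.∣-∣-cong (toℚᵘ-⌜⌝ x) ⟩
  mkℚᵘ (+ ℤ.∣ x ∣) 0      ≈⟨ toℚᵘ-⌜⌝ (+ ℤ.∣ x ∣) ⟨
  toℚᵘ ⌜ + ℤ.∣ x ∣ ⌝      ∎)
  where open ℚᵘ.≃-Reasoning

⌜⌝-mono-≤ : ∀ {x y} → x ℤ.≤ y → ⌜ x ⌝ ≤ ⌜ y ⌝
⌜⌝-mono-≤ {x} {y} x≤y = toℚᵘ-cancel-≤ (begin
  toℚᵘ ⌜ x ⌝   ≃⟨ toℚᵘ-⌜⌝ x ⟩
  mkℚᵘ x 0     ≤⟨ ℚᵘ.*≤* (ℤ.*-monoʳ-≤-nonNeg (+ 1) x≤y) ⟩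
  mkℚᵘ y 0     ≃⟨ toℚᵘ-⌜⌝ y ⟨
  toℚᵘ ⌜ y ⌝   ∎)
  where open ℚᵘ.≤-Reasoning

⌜⌝-mono-< : ∀ {x y} → x ℤ.< y → ⌜ x ⌝ < ⌜ y ⌝
⌜⌝-mono-< {x} {y} x<y = toℚᵘ-cancel-< (begin-strict
  toℚᵘ ⌜ x ⌝   ≃⟨ toℚᵘ-⌜⌝ x ⟩
  mkℚᵘ x 0     <⟨ ℚᵘ.*<* (ℤ.*-monoʳ-<-pos (+ 1) x<y) ⟩
  mkℚᵘ y 0     ≃⟨ toℚᵘ-⌜⌝ y ⟨
  toℚᵘ ⌜ y ⌝   ∎)
  where open ℚᵘ.≤-Reasoning

⌜⌝-injective : ∀ {x y} → ⌜ x ⌝ ≡ ⌜ y ⌝ → x ≡ y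
⌜⌝-injective {x} {y} eq with fromℚᵘ-injective {mkℚᵘ x 0} {mkℚᵘ y 0} eq
... | *≡* eq′ = trans (sym (ℤ.*-identityʳ x)) (trans eq′ (ℤ.*-identityʳ y))

q*↧q≡↥q : ∀ q → q * ⌜ ↧ q ⌝ ≡ ⌜ ↥ q ⌝
q*↧q≡↥q q@(mkℚ n d _) = toℚᵘ-injective (begin
  toℚᵘ (q * ⌜ ↧ q ⌝)             ≈⟨ toℚᵘ-homo-* q ⌜ ↧ q ⌝ ⟩
  mkℚᵘ n d ℚᵘ.* toℚᵘ ⌜ ↧ q ⌝     ≈⟨ ℚᵘ.*-congˡ {mkℚᵘ n d} (toℚᵘ-⌜⌝ (↧ q)) ⟩
  mkℚᵘ n d ℚᵘ.* mkℚᵘ (↧ q) 0     ≈⟨ *≡* (trans (ℤ.*-identityʳ (n ℤ.* ↧ q)) (cong (λ k → n ℤ.* (+ k)) (sym (ℕ.*-identityʳ (suc d))))) ⟩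
  mkℚᵘ n 0                       ≈⟨ toℚᵘ-⌜⌝ n ⟨
  toℚᵘ ⌜ n ⌝                     ∎)
  where open ℚᵘ.≃-Reasoning

1/n*n≡1 : ∀ n .{{_ : ℕ.NonZero n}} → (+ 1 / n) * ⌜ + n ⌝ ≡ 1ℚ
1/n*n≡1 n@(suc n-1) = toℚᵘ-injective (begin
  toℚᵘ ((+ 1 / n) * ⌜ + n ⌝)               ≈⟨ toℚᵘ-homo-* (+ 1 / n) ⌜ + n ⌝ ⟩
  toℚᵘ (+ 1 / n) ℚᵘ.* toℚᵘ ⌜ + n ⌝         ≈⟨ ℚᵘ.*-cong (toℚᵘ-fromℚᵘ (mkℚᵘ (+ 1) n-1)) (toℚᵘ-⌜⌝ (+ n)) ⟩
  mkℚᵘ (+ 1) n-1 ℚᵘ.* mkℚᵘ (+ n) 0         ≈⟨ *≡* (trans (ℤ.*-identityʳ _) (cong (λ k → + 1 ℤ.* (+ k)) (sym (ℕ.*-identityʳ n)))) ⟩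
  ℚᵘ.1ℚᵘ                                   ∎)
  where open ℚᵘ.≃-Reasoning

⌜⌝-pos : ∀ n .{{_ : ℕ.NonZero n}} → Positive ⌜ + n ⌝
⌜⌝-pos n = positive (⌜⌝-mono-< (ℤ.+<+ (ℕ.>-nonZero⁻¹ n)))

*-cancelʳ-⌜⌝ : ∀ {x y} n .{{_ : ℕ.NonZero n}} → x * ⌜ + n ⌝ ≡ y * ⌜ + n ⌝ → x ≡ y
*-cancelʳ-⌜⌝ n eq = ≤-antisym (cancel (≤-reflexive eq)) (cancel (≤-reflexive (sym eq)))
  where
  cancel : ∀ {x y} → x * ⌜ + n ⌝ ≤ y * ⌜ + n ⌝ → x ≤ y
  cancel = *-cancelʳ-≤-pos ⌜ + n ⌝ {{⌜⌝-pos n}}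

-- Null sequences, and ring homomorphisms from ℚ to a completion.

-- v ≃ w in the completion unfolds to Null abs (λ n → v n - w n).
Null : (ℚ → ℚ) → Seq → Set
Null abs u = ∀ ε → 0ℚ < ε → ∃[ N ] ∀ n → N ℕ.≤ n → abs (u n) < ε

-- Kept general in `abs` so that one argument serves both ℝ and ℚ_p; closure under sums and rational
-- multiples is all it asks of the absolute value.
module NullIdeal (abs : ℚ → ℚ)
  (null-+ : ∀ {u v} → Null abs u → Null abs v → Null abs (λ n → u n + v n))
  (null-* : ∀ x {u} → Null abs u → Null abs (λ n → x * u n))
  where

  open Completion abs

  null-resp : ∀ {u v} → (∀ n → u n ≡ v n) → Null abs u → Null abs v
  null-resp u≗v null ε ε>0 with N , small ← null ε ε>0 =
    N , λ n N≤n → subst (λ x → abs x < ε) (u≗v n) (small n N≤n)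

  ≃-trans : Transitive _≃_
  ≃-trans {u} {v} {w} u≃v v≃w =
    null-resp (λ n → solve 3 (λ x y z → (x :- y) :+ (y :- z) := x :- z) refl (u n) (v n) (w n))
      (null-+ {λ n → u n - v n} {λ n → v n - w n} u≃v v≃w)

  module Constant {φ : ℚ → Seq} (hom : IsRingHomomorphism +-*-rawRing seqRing φ) where
    open IsRingHomomorphism hom

    Const : ℚ → Set
    Const q = φ q ≃ (λ _ → q)

    const-+ : ∀ {q r} → Const q → Const r → Const (q + r)
    const-+ {q} {r} cq cr =
      null-resp (λ n → solve 5 (λ s x y q r → (s :- (x :+ y)) :+ ((x :- q) :+ (y :- r)) := s :- (q :+ r))
                  refl (φ (q + r) n) (φ q n) (φ r n) q r)
        (null-+ {λ n → φ (q + r) n - (φ q n + φ r n)} (+-homo q r)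
          (null-+ {λ n → φ q n - q} {λ n → φ r n - r} cq cr))

    const-neg : ∀ {q} → Const q → Const (- q)
    const-neg {q} cq =
      null-resp (λ n → solve 3 (λ s x q → (s :- (:- x)) :+ (con (- 1ℚ) :* (x :- q)) := s :- (:- q))
                  refl (φ (- q) n) (φ q n) q)
        (null-+ {λ n → φ (- q) n - (- φ q n)} (-‿homo q) (null-* (- 1ℚ) {λ n → φ q n - q} cq))

    const-ℕ : ∀ n → Const ⌜ + n ⌝
    const-ℕ zero    = 0#-homo
    const-ℕ (suc n) = subst Const (sym (⌜⌝-+ (+ 1) (+ n))) (const-+ 1#-homo (const-ℕ n))

    const-ℤ : ∀ z → Const ⌜ z ⌝
    const-ℤ (+ n)    = const-ℕ n
    const-ℤ -[1+ n ] = const-neg (const-ℕ (suc n))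

    -- Derived from additivity by induction on `n`. Going through `*-homo` would leave a null
    -- sequence times `φ q`, and `null-*` covers constant factors only.
    multiple : ∀ n q → φ (⌜ + n ⌝ * q) ≃ (λ k → ⌜ + n ⌝ * φ q k)
    multiple zero q =
      null-resp (λ k → trans (cong (λ x → φ x k - 0ℚ) (sym (*-zeroˡ q)))
                         (cong (_-_ (φ (0ℚ * q) k)) (sym (*-zeroˡ (φ q k)))))
        0#-homo
    multiple (suc n) q =
      null-resp (λ k → trans
                  (solve 4 (λ s x y m → (s :- (x :+ y)) :+ (y :- m :* x) := s :- (con 1ℚ :+ m) :* x)
                    refl (φ (q + ⌜ + n ⌝ * q) k) (φ q k) (φ (⌜ + n ⌝ * q) k) ⌜ + n ⌝)
                  (cong₂ _-_ (cong (λ x → φ x k) (trans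
                      (solve 2 (λ q m → q :+ m :* q := (con 1ℚ :+ m) :* q) refl q ⌜ + n ⌝)
                      (cong (_* q) (sym (⌜⌝-+ (+ 1) (+ n))))))
                    (cong (_* φ q k) (sym (⌜⌝-+ (+ 1) (+ n))))))
        (null-+ {λ k → φ (q + ⌜ + n ⌝ * q) k - (φ q k + φ (⌜ + n ⌝ * q) k)}
          (+-homo q (⌜ + n ⌝ * q)) (multiple n q))

    -- With `D` the denominator of `q`, the sequence `φ (D * q)` is close to `D * φ q` by `multiple`
    -- and to the integer `D * q` by `const-ℤ`. Hence `D * (φ q - q)` is null, and so is its
    -- multiple by 1 / `D`.
    const : ∀ q → Const q
    const q = null-resp (λ k → begin
        (+ 1 / ↧ₙ q) * ((- 1ℚ) * (φ (D * q) k - D * φ q k) + (φ ⌜ ↥ q ⌝ k - ⌜ ↥ q ⌝))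
          ≡⟨ cong (λ x → (+ 1 / ↧ₙ q) * ((- 1ℚ) * (φ (D * q) k - D * φ q k) + (φ x k - x))) (sym D*q≡) ⟩
        (+ 1 / ↧ₙ q) * ((- 1ℚ) * (φ (D * q) k - D * φ q k) + (φ (D * q) k - D * q))
          ≡⟨ solve 5 (λ i s d x q → i :* (con (- 1ℚ) :* (s :- d :* x) :+ (s :- d :* q)) := (i :* d) :* (x :- q))
               refl (+ 1 / ↧ₙ q) (φ (D * q) k) D (φ q k) q ⟩
        ((+ 1 / ↧ₙ q) * D) * (φ q k - q)
          ≡⟨ cong (_* (φ q k - q)) (1/n*n≡1 (↧ₙ q)) ⟩
        1ℚ * (φ q k - q)
          ≡⟨ *-identityˡ _ ⟩
        φ q k - q ∎)
      (null-* (+ 1 / ↧ₙ q) {λ k → (- 1ℚ) * (φ (D * q) k - D * φ q k) + (φ ⌜ ↥ q ⌝ k - ⌜ ↥ q ⌝)}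
        (null-+ {λ k → (- 1ℚ) * (φ (D * q) k - D * φ q k)}
          (null-* (- 1ℚ) {λ k → φ (D * q) k - D * φ q k} (multiple (↧ₙ q) q))
          (const-ℤ (↥ q))))
      where
      open ≡-Reasoning
      D = ⌜ ↧ q ⌝
      D*q≡ : D * q ≡ ⌜ ↥ q ⌝
      D*q≡ = trans (*-comm D q) (q*↧q≡↥q q)

-- Null sequences for the usual absolute value.

halve : ∀ {ε} → 0ℚ < ε → 0ℚ < ε * ½
halve {ε} ε>0 = positive⁻¹ (ε * ½) {{pos*pos⇒pos ε {{positive ε>0}} ½}}

halves : ∀ ε → ε * ½ + ε * ½ ≡ ε
halves ε = trans (sym (*-distribˡ-+ ε ½ ½)) (*-identityʳ ε)

∣∣-null-+ : ∀ {u v} → Null ∣_∣ u → Null ∣_∣ v → Null ∣_∣ (λ n → u n + v n)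
∣∣-null-+ {u} {v} nu nv ε ε>0
  with N , small ← nu (ε * ½) (halve ε>0) | M , small′ ← nv (ε * ½) (halve ε>0) =
  N ℕ.⊔ M , λ n le → begin-strict
    ∣ u n + v n ∣       ≤⟨ ∣p+q∣≤∣p∣+∣q∣ (u n) (v n) ⟩
    ∣ u n ∣ + ∣ v n ∣   <⟨ +-mono-< (small n (ℕ.≤-trans (ℕ.m≤m⊔n N M) le)) (small′ n (ℕ.≤-trans (ℕ.m≤n⊔m N M) le)) ⟩
    ε * ½ + ε * ½       ≡⟨ halves ε ⟩
    ε                   ∎
  where open ≤-Reasoning

∣∣-null-* : ∀ x {u} → Null ∣_∣ u → Null ∣_∣ (λ n → x * u n)
∣∣-null-* x {u} nu ε ε>0 =
  proj₁ eventually , λ n le → begin-strict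
    ∣ x * u n ∣         ≡⟨ ∣p*q∣≡∣p∣*∣q∣ x (u n) ⟩
    ∣ x ∣ * ∣ u n ∣     ≤⟨ *-monoʳ-≤-nonNeg ∣ u n ∣ {{∣-∣-nonNeg (u n)}} ∣x∣≤M ⟩
    M * ∣ u n ∣         <⟨ *-monoʳ-<-pos M (proj₂ eventually n le) ⟩
    M * (ε * 1/ M)      ≡⟨ solve 3 (λ m e i → m :* (e :* i) := e :* (m :* i)) refl M ε (1/ M) ⟩
    ε * (M * 1/ M)      ≡⟨ cong (ε *_) (*-inverseʳ M) ⟩
    ε * 1ℚ              ≡⟨ *-identityʳ ε ⟩
    ε                   ∎
  where
  open ≤-Reasoning
  -- The summand 1 keeps `M` invertible when `x` is 0.
  M = 1ℚ + ∣ x ∣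
  instance
    M-pos : Positive M
    M-pos = pos+nonNeg⇒pos 1ℚ ∣ x ∣ {{∣-∣-nonNeg x}}
    M-nonZero : NonZero M
    M-nonZero = pos⇒nonZero M
  ∣x∣≤M : ∣ x ∣ ≤ M
  ∣x∣≤M = subst (_≤ M) (+-identityˡ ∣ x ∣) (+-monoˡ-≤ ∣ x ∣ (nonNegative⁻¹ 1ℚ))
  ε/M>0 : 0ℚ < ε * 1/ M
  ε/M>0 = positive⁻¹ (ε * 1/ M) {{pos*pos⇒pos ε {{positive ε>0}} (1/ M) {{1/pos⇒pos M}}}}
  eventually = nu (ε * 1/ M) ε/M>0

-- The exponent of p in a natural number.

mutual
  multiplicityGo : ℕ → ℕ → ℕ → ℕ → ℕ
  multiplicityGo = _

  -- Defs hides the recursion behind `multiplicity` in a where block; unifying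
  -- with its unfolding names it.
  multiplicity-unfold : ∀ p k → ∃[ r ] multiplicity p (suc k) ≡ r
  multiplicity-unfold p k with suc k | p ∣? suc k
  ... | w | yes (divides q _) = suc (multiplicityGo p w k q) , refl
  ... | w | no  _             = 0 , refl

-- Here `n` is the variable captured by the hidden recursion and stays fixed. Fuel `m` is enough
-- because each division by p makes the quotient strictly smaller.
multiplicityGo-spec : ∀ p .{{_ : ℕ.NonTrivial p}} n fuel m .{{_ : ℕ.NonZero m}} → m ℕ.≤ fuel →
  ∃[ r ] ¬ p ∣ r × m ≡ r ℕ.* p ℕ.^ multiplicityGo p n fuel m
multiplicityGo-spec p n zero       m@(suc _) ()
multiplicityGo-spec p n (suc fuel) m m≤fuel with p ∣? m
... | no p∤m = m , p∤m , sym (ℕ.*-identityʳ m)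
... | yes p∣m@(divides q m≡q*p)
  with r , p∤r , q≡ ← multiplicityGo-spec p n fuel q {{quotient≢0 p∣m}}
                        (ℕ.≤-pred (ℕ.≤-trans (quotient-< p∣m) m≤fuel)) =
  r , p∤r , trans m≡q*p (trans (cong (ℕ._* p) q≡)
    (trans (ℕ.*-assoc r _ p) (cong (r ℕ.*_) (ℕ.*-comm _ p))))

multiplicity-spec : ∀ p .{{_ : ℕ.NonTrivial p}} m .{{_ : ℕ.NonZero m}} →
  ∃[ r ] ¬ p ∣ r × m ≡ r ℕ.* p ℕ.^ multiplicity p m
multiplicity-spec p m = multiplicityGo-spec p m m m ℕ.≤-refl

∑<-*ʳ : ∀ n {f g : ℕ → ℚ} x → (∀ j → f j * x ≡ g j) → ∑< n f * x ≡ ∑< n g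
∑<-*ʳ zero    x f*x≡g = *-zeroˡ x
∑<-*ʳ (suc n) {f} x f*x≡g = trans (*-distribʳ-+ x (∑< n f) (f n)) (cong₂ _+_ (∑<-*ʳ n x f*x≡g) (f*x≡g n))

n<m^n : ∀ m → 1 ℕ.< m → ∀ n → n ℕ.< m ℕ.^ n
n<m^n m 1<m zero    = ℕ.s≤s ℕ.z≤n
n<m^n m 1<m (suc n) = begin-strict
  suc n            ≤⟨ n<m^n m 1<m n ⟩
  m ℕ.^ n          <⟨ ℕ.m<m*n (m ℕ.^ n) m {{ℕ.m^n≢0 m n {{ℕ.>-nonZero (ℕ.<-trans ℕ.0<1+n 1<m)}}}} 1<m ⟩
  m ℕ.^ n ℕ.* m    ≡⟨ ℕ.*-comm _ m ⟩
  m ℕ.^ suc n      ∎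
  where open ℕ.≤-Reasoning

-- p-adic null sequences, expressed by divisibility.

module PAdicProperties (p : ℕ) (p-prime : Prime p) where
  open PAdic p p-prime

  instance
    p-nonZero : ℕ.NonZero p
    p-nonZero = prime⇒nonZero p-prime
    p-nonTrivial : ℕ.NonTrivial p
    p-nonTrivial = prime⇒nonTrivial p-prime

  p^≢0 : ∀ n → ℕ.NonZero (p ℕ.^ n)
  p^≢0 n = ℕ.m^n≢0 p n

  P : ℕ → ℚ
  P n = p^ (+ n)

  P-+ : ∀ m n → P (m ℕ.+ n) ≡ P m * P n
  P-+ m n = trans (cong (λ k → ⌜ + k ⌝) (ℕ.^-distribˡ-+-* p m n))
    (⌜⌝-ℕ* (p ℕ.^ m) (p ℕ.^ n))

  P-pos : ∀ n → Positive (P n)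
  P-pos n = ⌜⌝-pos (p ℕ.^ n) {{p^≢0 n}}

  1≤P : ∀ n → 1ℚ ≤ P n
  1≤P n = ⌜⌝-mono-≤ (ℤ.+≤+ (ℕ.>-nonZero⁻¹ (p ℕ.^ n) {{p^≢0 n}}))

  p^-⊖ : ∀ m n → p^ (m ⊖ n) * P n ≡ P m
  p^-⊖ m       zero    = *-identityʳ (P m)
  p^-⊖ zero    (suc n) = 1/n*n≡1 (p ℕ.^ suc n) {{p^≢0 (suc n)}}
  p^-⊖ (suc m) (suc n) = begin
    p^ (suc m ⊖ suc n) * P (suc n)    ≡⟨ cong₂ (λ k x → p^ k * x) (ℤ.[1+m]⊖[1+n]≡m⊖n m n) (P-+ 1 n) ⟩
    p^ (m ⊖ n) * (P 1 * P n)          ≡⟨ solve 3 (λ x y z → x :* (y :* z) := y :* (x :* z)) refl (p^ (m ⊖ n)) (P 1) (P n) ⟩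
    P 1 * (p^ (m ⊖ n) * P n)          ≡⟨ cong (P 1 *_) (p^-⊖ m n) ⟩
    P 1 * P m                         ≡⟨ P-+ 1 m ⟨
    P (suc m)                         ∎
    where open ≡-Reasoning

  p^-pos : ∀ z → Positive (p^ z)
  p^-pos (+ n)    = P-pos n
  p^-pos -[1+ n ] = normalize-pos 1 (p ℕ.^ suc n) {{p^≢0 (suc n)}}

  p∤-* : ∀ {m n} → ¬ p ∣ m → ¬ p ∣ n → ¬ p ∣ m ℕ.* n
  p∤-* {m} {n} p∤m p∤n p∣mn = [ p∤m , p∤n ]′ (euclidsLemma m n p-prime p∣mn)

  p∤1 : ¬ p ∣ 1
  p∤1 (divides zero ())
  p∤1 (divides (suc q) eq) = ℕ.nonTrivial⇒≢1 {p} (ℕ.m*n≡1⇒n≡1 (suc q) p (sym eq))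

  p∤⇒nonZero : ∀ {n} → ¬ p ∣ n → ℕ.NonZero n
  p∤⇒nonZero p∤n = ℕ.≢-nonZero λ { refl → p∤n (p ∣0) }

  -- Induction on `k`: Euclid's lemma places one factor p in `m`, and cancelling it on both sides
  -- leaves the claim for `k` and `m` / p.
  p^-divisor : ∀ k m {n} → ¬ p ∣ n → p ℕ.^ k ∣ m ℕ.* n → p ℕ.^ k ∣ m
  p^-divisor zero    m {n} p∤n _ = divides m (sym (ℕ.*-identityʳ m))
  p^-divisor (suc k) m {n} p∤n p^∣mn
    with euclidsLemma m n p-prime (∣-trans (m∣m*n (p ℕ.^ k)) p^∣mn)
  ... | inj₂ p∣n = contradiction p∣n p∤n
  ... | inj₁ (divides m′ refl) with divides c eq ← p^∣mn
    with divides d eq′ ← p^-divisor k m′ p∤n (divides c (ℕ.*-cancelʳ-≡ (m′ ℕ.* n) (c ℕ.* p ℕ.^ k) p 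
      (trans (ℕS.solve 3 (λ x y z → x ℕS.:* y ℕS.:* z ℕS.:= x ℕS.:* z ℕS.:* y) refl m′ n p)
        (trans eq (ℕS.solve 3 (λ x y z → x ℕS.:* (y ℕS.:* z) ℕS.:= x ℕS.:* z ℕS.:* y) refl c p (p ℕ.^ k)))))) =
    divides d (trans (cong (ℕ._* p) eq′)
      (ℕS.solve 3 (λ x y z → x ℕS.:* y ℕS.:* z ℕS.:= x ℕS.:* (z ℕS.:* y)) refl d (p ℕ.^ k) p))

  -- Removing the part of `m` prime to p leaves one power of p dividing another, and then sizes
  -- decide.
  p^∣⇒≤multiplicity : ∀ k m .{{_ : ℕ.NonZero m}} → p ℕ.^ k ∣ m → k ℕ.≤ multiplicity p m
  p^∣⇒≤multiplicity k m p^k∣m with r , p∤r , m≡ ← multiplicity-spec p m =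
    ℕ.≮⇒≥ λ v<k → ℕ.<⇒≱ (ℕ.^-monoʳ-< p (ℕ.nonTrivial⇒n>1 p) v<k)
      (∣⇒≤ {{p^≢0 (multiplicity p m)}} (p^-divisor k (p ℕ.^ multiplicity p m) p∤r
        (subst (p ℕ.^ k ∣_) (trans m≡ (ℕ.*-comm r _)) p^k∣m)))

  p∤⇒multiplicity≡0 : ∀ m .{{_ : ℕ.NonZero m}} → ¬ p ∣ m → multiplicity p m ≡ 0
  p∤⇒multiplicity≡0 m p∤m with multiplicity p m | multiplicity-spec p m
  ... | zero  | _ = refl
  ... | suc v | r , _ , m≡ =
    contradiction (subst (p ∣_) (sym m≡) (∣n⇒∣m*n r (m∣m*n (p ℕ.^ v)))) p∤m

  -- Divisible k x: x ∈ pᵏ ℤ_(p).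
  Divisible : ℕ → ℚ → Set
  Divisible k x = ∃[ a ] ∃[ b ] ¬ p ∣ b × x * ⌜ + b ⌝ ≡ ⌜ a ⌝ * P k

  divisible-+ : ∀ {k x y} → Divisible k x → Divisible k y → Divisible k (x + y)
  divisible-+ {k} {x} {y} (a , b , p∤b , xb≡) (c , d , p∤d , yd≡) =
    a ℤ.* + d ℤ.+ c ℤ.* + b , b ℕ.* d , p∤-* p∤b p∤d , (begin
      (x + y) * ⌜ + (b ℕ.* d) ⌝                     ≡⟨ cong ((x + y) *_) (⌜⌝-ℕ* b d) ⟩
      (x + y) * (⌜ + b ⌝ * ⌜ + d ⌝)                 ≡⟨ solve 4 (λ x y b d → (x :+ y) :* (b :* d) := (x :* b) :* d :+ (y :* d) :* b) refl x y ⌜ + b ⌝ ⌜ + d ⌝ ⟩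
      (x * ⌜ + b ⌝) * ⌜ + d ⌝ + (y * ⌜ + d ⌝) * ⌜ + b ⌝  ≡⟨ cong₂ (λ s t → s * ⌜ + d ⌝ + t * ⌜ + b ⌝) xb≡ yd≡ ⟩
      (⌜ a ⌝ * P k) * ⌜ + d ⌝ + (⌜ c ⌝ * P k) * ⌜ + b ⌝  ≡⟨ solve 5 (λ a k d c b → (a :* k) :* d :+ (c :* k) :* b := (a :* d :+ c :* b) :* k) refl ⌜ a ⌝ (P k) ⌜ + d ⌝ ⌜ c ⌝ ⌜ + b ⌝ ⟩
      (⌜ a ⌝ * ⌜ + d ⌝ + ⌜ c ⌝ * ⌜ + b ⌝) * P k     ≡⟨ cong (_* P k) (trans (⌜⌝-+ (a ℤ.* + d) (c ℤ.* + b)) (cong₂ _+_ (⌜⌝-* a (+ d)) (⌜⌝-* c (+ b)))) ⟨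
      ⌜ a ℤ.* + d ℤ.+ c ℤ.* + b ⌝ * P k             ∎)
    where open ≡-Reasoning

  -- The equation q = A / (B pᵈ) with the division cleared. `B` is an index because the descent runs
  -- on it, while `d` may grow from term to term.
  record Fraction (q : ℚ) (B : ℕ) : Set where
    field
      A   : ℤ
      d   : ℕ
      p∤B : ¬ p ∣ B
      eq  : q * (⌜ + B ⌝ * P d) ≡ ⌜ A ⌝

  fraction : ∀ q → ∃[ B ] Fraction q B
  fraction q with B , p∤B , ↧≡ ← multiplicity-spec p (↧ₙ q) = B , record
    { A = ↥ q
    ; d = multiplicity p (↧ₙ q)
    ; p∤B = p∤B
    ; eq = trans (cong (q *_) (trans (sym (⌜⌝-ℕ* B (p ℕ.^ multiplicity p (↧ₙ q)))) (cong (λ n → ⌜ + n ⌝) (sym ↧≡))))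
        (q*↧q≡↥q q)
    }

  -- The denominator of `x` may cancel up to `d` factors p of `y`, hence the reserve of `d` in the
  -- hypothesis.
  divisible-* : ∀ {k x y B} (f : Fraction x B) → Divisible (k ℕ.+ Fraction.d f) y → Divisible k (x * y)
  divisible-* {k} {x} {y} {B} f (a , b , p∤b , yb≡) =
    A ℤ.* a , B ℕ.* b , p∤-* p∤B p∤b , *-cancelʳ-⌜⌝ (p ℕ.^ d) {{p^≢0 d}} (begin
      (x * y) * ⌜ + (B ℕ.* b) ⌝ * P d               ≡⟨ cong (λ z → (x * y) * z * P d) (⌜⌝-ℕ* B b) ⟩
      (x * y) * (⌜ + B ⌝ * ⌜ + b ⌝) * P d           ≡⟨ solve 5 (λ x y B b d → (x :* y) :* (B :* b) :* d := (x :* (B :* d)) :* (y :* b)) refl x y ⌜ + B ⌝ ⌜ + b ⌝ (P d) ⟩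
      (x * (⌜ + B ⌝ * P d)) * (y * ⌜ + b ⌝)         ≡⟨ cong₂ _*_ eq yb≡ ⟩
      ⌜ A ⌝ * (⌜ a ⌝ * P (k ℕ.+ d))                 ≡⟨ cong (λ z → ⌜ A ⌝ * (⌜ a ⌝ * z)) (P-+ k d) ⟩
      ⌜ A ⌝ * (⌜ a ⌝ * (P k * P d))                 ≡⟨ solve 4 (λ A a k d → A :* (a :* (k :* d)) := (A :* a) :* k :* d) refl ⌜ A ⌝ ⌜ a ⌝ (P k) (P d) ⟩
      (⌜ A ⌝ * ⌜ a ⌝) * P k * P d                   ≡⟨ cong (λ z → z * P k * P d) (⌜⌝-* A a) ⟨
      ⌜ A ℤ.* a ⌝ * P k * P d                       ∎)
    where
    open ≡-Reasoning
    open Fraction f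

  -- The product form trades the possibly negative exponent in `∣ q ∣ₚ` for an equation between
  -- natural powers of p.
  ∣q∣ₚ*p^ : ∀ {q} → q ≢ 0ℚ →
    ∣ q ∣ₚ * P (multiplicity p ℤ.∣ ↥ q ∣) ≡ P (multiplicity p (↧ₙ q)) × 0ℚ < ∣ q ∣ₚ
  ∣q∣ₚ*p^ {q} q≢0 with q ≟ 0ℚ
  ... | yes q≡0 = contradiction q≡0 q≢0
  ... | no  _   =
    trans (cong (λ k → p^ k * P m) (trans (cong ℤ.-_ (ℤ.m-n≡m⊖n m n)) (sym (ℤ.⊖-swap n m)))) (p^-⊖ n m)
    , positive⁻¹ _ {{p^-pos (ℤ.- valuation q)}}
    where
    m = multiplicity p ℤ.∣ ↥ q ∣
    n = multiplicity p (↧ₙ q)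

  ∣0∣ₚ : ∀ {q} → q ≡ 0ℚ → ∣ q ∣ₚ ≡ 0ℚ
  ∣0∣ₚ {q} q≡0 with q ≟ 0ℚ
  ... | yes _   = refl
  ... | no  q≢0 = contradiction q≡0 q≢0

  P-mono : ∀ {m n} → m ℕ.≤ n → P m ≤ P n
  P-mono {m} {n} m≤n = ⌜⌝-mono-≤ (ℤ.+≤+ (ℕ.^-monoʳ-≤ p m≤n))

  numerator-nonZero : ∀ {q} → q ≢ 0ℚ → ℕ.NonZero ℤ.∣ ↥ q ∣
  numerator-nonZero {q} q≢0 = ℕ.≢-nonZero λ ∣↥∣≡0 → q≢0 (↥p≡0⇒p≡0 q (ℤ.∣i∣≡0⇒i≡0 ∣↥∣≡0))

  p^-mono-∣ : ∀ {m n} → m ℕ.≤ n → p ℕ.^ m ∣ p ℕ.^ n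
  p^-mono-∣ {m} {n} m≤n = divides (p ℕ.^ (n ℕ.∸ m))
    (trans (cong (p ℕ.^_) (sym (ℕ.m∸n+n≡m m≤n))) (ℕ.^-distribˡ-+-* p (n ℕ.∸ m) m))

  p∣↥⇒p∤↧ : ∀ q → p ∣ ℤ.∣ ↥ q ∣ → ¬ p ∣ ↧ₙ q
  p∣↥⇒p∤↧ (mkℚ _ _ coprime) p∣↥ p∣↧ = ℕ.nonTrivial⇒≢1 {p} (recompute coprime (p∣↥ , p∣↧))

  -- For nonzero `q` with `v` factors p in its numerator, `∣ q ∣ₚ * P v` is a power of p and so at
  -- least 1; the strict bound then forces `k < v`.
  small⇒divisible : ∀ k q → ∣ q ∣ₚ * P k < 1ℚ → Divisible k q
  small⇒divisible k q small = helper (q ≟ 0ℚ)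
    where
    helper : Dec (q ≡ 0ℚ) → Divisible k q
    helper (yes q≡0) = + 0 , 1 , p∤1 , trans (*-identityʳ q) (trans q≡0 (sym (*-zeroˡ (P k))))
    helper (no q≢0)
      with r , _ , ∣↥∣≡ ← multiplicity-spec p ℤ.∣ ↥ q ∣ {{numerator-nonZero q≢0}}
         | ∣q∣*≡ , ∣q∣>0 ← ∣q∣ₚ*p^ q≢0 =
      -- The strict inequality `k < v` puts at least one p in the numerator, even for `k` = 0, so
      -- the reduced denominator is prime to p and can serve as the witness.
      a , ↧ₙ q , p∣↥⇒p∤↧ q (∣-trans (m∣m*n (p ℕ.^ k)) (p^∣↥ k<v)) ,
      trans (q*↧q≡↥q q) (trans (cong ⌜_⌝ ↥≡) (⌜⌝-* a (+ (p ℕ.^ k))))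
      where
      v = multiplicity p ℤ.∣ ↥ q ∣
      k<v : k ℕ.< v
      k<v = ℕ.≰⇒> λ v≤k → <-irrefl refl (begin-strict
        1ℚ                              ≤⟨ 1≤P (multiplicity p (↧ₙ q)) ⟩
        P (multiplicity p (↧ₙ q))       ≡⟨ ∣q∣*≡ ⟨
        ∣ q ∣ₚ * P v                    ≤⟨ *-monoˡ-≤-nonNeg ∣ q ∣ₚ {{nonNegative (<⇒≤ ∣q∣>0)}} (P-mono v≤k) ⟩
        ∣ q ∣ₚ * P k                    <⟨ small ⟩
        1ℚ                              ∎)
        where open ≤-Reasoning
      p^∣↥ : ∀ {j} → j ℕ.≤ v → p ℕ.^ j ∣ ℤ.∣ ↥ q ∣
      p^∣↥ {j} j≤v = subst (p ℕ.^ j ∣_) (sym ∣↥∣≡) (∣n⇒∣m*n r (p^-mono-∣ j≤v))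
      p^k∣↥ = ∣ᵤ⇒∣ {+ (p ℕ.^ k)} {↥ q} (p^∣↥ (ℕ.<⇒≤ k<v))
      a = _∣ℤ_.quotient p^k∣↥
      ↥≡ = _∣ℤ_.equality p^k∣↥

  -- The exponent `suc k` guarantees a factor p in the numerator of a nonzero `q`, so its reduced
  -- denominator contributes no power of p.
  divisible⇒small : ∀ k q → Divisible (suc k) q → ∣ q ∣ₚ * P (suc k) ≤ 1ℚ
  divisible⇒small k q (a , b , p∤b , qb≡) = helper (q ≟ 0ℚ)
    where
    helper : Dec (q ≡ 0ℚ) → ∣ q ∣ₚ * P (suc k) ≤ 1ℚ
    helper (yes q≡0) = begin
      ∣ q ∣ₚ * P (suc k)   ≡⟨ cong (_* P (suc k)) (∣0∣ₚ q≡0) ⟩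
      0ℚ * P (suc k)       ≡⟨ *-zeroˡ (P (suc k)) ⟩
      0ℚ                   ≤⟨ nonNegative⁻¹ 1ℚ ⟩
      1ℚ                   ∎
      where open ≤-Reasoning
    helper (no q≢0) = begin
      ∣ q ∣ₚ * P (suc k)                       ≤⟨ *-monoˡ-≤-nonNeg ∣ q ∣ₚ {{nonNegative (<⇒≤ (proj₂ (∣q∣ₚ*p^ q≢0)))}} (P-mono 1+k≤v) ⟩
      ∣ q ∣ₚ * P (multiplicity p ℤ.∣ ↥ q ∣)    ≡⟨ proj₁ (∣q∣ₚ*p^ q≢0) ⟩
      P (multiplicity p (↧ₙ q))                ≡⟨ cong P (p∤⇒multiplicity≡0 (↧ₙ q) (p∣↥⇒p∤↧ q (∣-trans (m∣m*n (p ℕ.^ k)) p^∣↥))) ⟩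
      1ℚ                                       ∎
      where
      open ≤-Reasoning
      ↥b≡ : ↥ q ℤ.* + b ≡ a ℤ.* ↧ q ℤ.* + (p ℕ.^ suc k)
      ↥b≡ = ⌜⌝-injective (EqR.begin
        ⌜ ↥ q ℤ.* + b ⌝                              EqR.≡⟨ ⌜⌝-* (↥ q) (+ b) ⟩
        ⌜ ↥ q ⌝ * ⌜ + b ⌝                            EqR.≡⟨ cong (_* ⌜ + b ⌝) (q*↧q≡↥q q) ⟨
        q * ⌜ ↧ q ⌝ * ⌜ + b ⌝                        EqR.≡⟨ solve 3 (λ q d b → q :* d :* b := (q :* b) :* d) refl q ⌜ ↧ q ⌝ ⌜ + b ⌝ ⟩
        (q * ⌜ + b ⌝) * ⌜ ↧ q ⌝                      EqR.≡⟨ cong (_* ⌜ ↧ q ⌝) qb≡ ⟩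
        (⌜ a ⌝ * P (suc k)) * ⌜ ↧ q ⌝                EqR.≡⟨ solve 3 (λ a k d → a :* k :* d := (a :* d) :* k) refl ⌜ a ⌝ (P (suc k)) ⌜ ↧ q ⌝ ⟩
        (⌜ a ⌝ * ⌜ ↧ q ⌝) * P (suc k)                EqR.≡⟨ cong (_* P (suc k)) (⌜⌝-* a (↧ q)) ⟨
        ⌜ a ℤ.* ↧ q ⌝ * P (suc k)                    EqR.≡⟨ ⌜⌝-* (a ℤ.* ↧ q) (+ (p ℕ.^ suc k)) ⟨
        ⌜ a ℤ.* ↧ q ℤ.* + (p ℕ.^ suc k) ⌝            EqR.∎)
        where module EqR = ≡-Reasoning
      p^∣↥ : p ℕ.^ suc k ∣ ℤ.∣ ↥ q ∣
      p^∣↥ = p^-divisor (suc k) ℤ.∣ ↥ q ∣ p∤b (divides ℤ.∣ a ℤ.* ↧ q ∣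
        (trans (sym (ℤ.abs-* (↥ q) (+ b))) (trans (cong ℤ.∣_∣ ↥b≡) (ℤ.abs-* (a ℤ.* ↧ q) (+ (p ℕ.^ suc k))))))
      1+k≤v : suc k ℕ.≤ multiplicity p ℤ.∣ ↥ q ∣
      1+k≤v = p^∣⇒≤multiplicity (suc k) ℤ.∣ ↥ q ∣ {{numerator-nonZero q≢0}} p^∣↥

  -- A positive `ε` times its denominator is a positive integer, hence at least 1, and pⁿ exceeds n;
  -- `suc k` is that denominator.
  archimedean : ∀ ε → 0ℚ < ε → ∃[ k ] 1ℚ < ε * P (suc k)
  archimedean ε ε>0 = k , (begin-strict
    1ℚ                 ≤⟨ ⌜⌝-mono-≤ (1≤↥ ε (positive ε>0)) ⟩
    ⌜ ↥ ε ⌝            ≡⟨ q*↧q≡↥q ε ⟨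
    ε * ⌜ ↧ ε ⌝        <⟨ *-monoʳ-<-pos ε {{positive ε>0}} (⌜⌝-mono-< (ℤ.+<+ (n<m^n p (ℕ.nonTrivial⇒n>1 p) (↧ₙ ε)))) ⟩
    ε * P (suc k)      ∎)
    where
    open ≤-Reasoning
    k = ℕ.pred (↧ₙ ε)
    1≤↥ : ∀ q → Positive q → + 1 ℤ.≤ ↥ q
    1≤↥ (mkℚ ℤ.+[1+ _ ] _ _) _ = ℤ.+≤+ (ℕ.s≤s ℕ.z≤n)

  -- Nullness restated so that sums and multiples are handled by arithmetic of fractions, in place
  -- of the ultrametric inequality and the multiplicativity of `∣_∣ₚ`.
  EventuallyDivisible : Seq → Set
  EventuallyDivisible u = ∀ k → ∃[ N ] ∀ n → N ℕ.≤ n → Divisible k (u n)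

  null⇒divisible : ∀ {u} → Null ∣_∣ₚ u → EventuallyDivisible u
  null⇒divisible {u} null k
    with N , small ← null (p^ (0 ⊖ k)) (positive⁻¹ _ {{p^-pos (0 ⊖ k)}}) =
    N , λ n N≤n → small⇒divisible k (u n) (subst (∣ u n ∣ₚ * P k <_) (p^-⊖ 0 k)
      (*-monoˡ-<-pos (P k) {{P-pos k}} (small n N≤n)))

  divisible⇒null : ∀ {u} → EventuallyDivisible u → Null ∣_∣ₚ u
  divisible⇒null {u} div ε ε>0
    with k , 1<εP ← archimedean ε ε>0 with N , divN ← div (suc k) =
    N , λ n N≤n → *-cancelʳ-<-nonNeg (P (suc k)) {{pos⇒nonNeg (P (suc k)) {{P-pos (suc k)}}}}
      (≤-<-trans (divisible⇒small k (u n) (divN n N≤n)) 1<εP)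

  null-+ : ∀ {u v} → Null ∣_∣ₚ u → Null ∣_∣ₚ v → Null ∣_∣ₚ (λ n → u n + v n)
  null-+ {u} {v} nu nv = divisible⇒null {λ n → u n + v n} λ k → sum k (null⇒divisible {u} nu k) (null⇒divisible {v} nv k)
    where
    sum : ∀ k → ∃[ N ] (∀ n → N ℕ.≤ n → Divisible k (u n)) → ∃[ N ] (∀ n → N ℕ.≤ n → Divisible k (v n)) →
      ∃[ N ] (∀ n → N ℕ.≤ n → Divisible k (u n + v n))
    sum k (N , du) (M , dv) = N ℕ.⊔ M , λ n le → divisible-+ {k} {u n} {v n}
      (du n (ℕ.≤-trans (ℕ.m≤m⊔n N M) le)) (dv n (ℕ.≤-trans (ℕ.m≤n⊔m N M) le))

  null-* : ∀ x {u} → Null ∣_∣ₚ u → Null ∣_∣ₚ (λ n → x * u n)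
  null-* x {u} nu = divisible⇒null {λ n → x * u n} λ k →
    let f = proj₂ (fraction x)
        N , du = null⇒divisible {u} nu (k ℕ.+ Fraction.d f)
    in N , λ n le → divisible-* {k} {x} {u n} f (du n le)

  open NullIdeal ∣_∣ₚ (λ {u} {v} → null-+ {u} {v}) (λ x {u} → null-* x {u}) public

  -- The p-adic digits of a rational number.

  p∤⇒coprime : ∀ {n} → ¬ p ∣ n → Coprime n p
  p∤⇒coprime p∤n (d∣n , d∣p) with prime⇒irreducible p-prime d∣p
  ... | inj₁ d≡1  = d≡1
  ... | inj₂ refl = contradiction d∣n p∤n

  bézout : ∀ {B} → ¬ p ∣ B → ∃[ u ] ∃[ v ] u ℤ.* + B ℤ.+ v ℤ.* + p ≡ + 1
  bézout {B} p∤B with coprime-Bézout (p∤⇒coprime p∤B)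
  ... | Bézout.+- x y eq = + x , ℤ.- (+ y) , (begin
    + x ℤ.* + B ℤ.+ (ℤ.- (+ y)) ℤ.* + p                 ≡⟨ cong (ℤ._+ (ℤ.- (+ y)) ℤ.* + p) (trans (sym (ℤ.pos-* x B)) (trans (cong +_ (sym eq)) (cong (ℤ._+_ (+ 1)) (ℤ.pos-* y p)))) ⟩
    + 1 ℤ.+ + y ℤ.* + p ℤ.+ (ℤ.- (+ y)) ℤ.* + p         ≡⟨ ℤS.solve 2 (λ y p → ℤS.con (+ 1) ℤS.:+ y ℤS.:* p ℤS.:+ (ℤS.:- y) ℤS.:* p ℤS.:= ℤS.con (+ 1)) refl (+ y) (+ p) ⟩
    + 1                                                 ∎)
    where open ≡-Reasoning
  ... | Bézout.-+ x y eq = ℤ.- (+ x) , + y , (begin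
    (ℤ.- (+ x)) ℤ.* + B ℤ.+ + y ℤ.* + p                 ≡⟨ cong (λ k → (ℤ.- (+ x)) ℤ.* + B ℤ.+ k) (trans (sym (ℤ.pos-* y p)) (trans (cong +_ (sym eq)) (cong (ℤ._+_ (+ 1)) (ℤ.pos-* x B)))) ⟩
    (ℤ.- (+ x)) ℤ.* + B ℤ.+ (+ 1 ℤ.+ + x ℤ.* + B)       ≡⟨ ℤS.solve 2 (λ x B → (ℤS.:- x) ℤS.:* B ℤS.:+ (ℤS.con (+ 1) ℤS.:+ x ℤS.:* B) ℤS.:= ℤS.con (+ 1)) refl (+ x) (+ B) ⟩
    + 1                                                 ∎)
    where open ≡-Reasoning

  -- The Bézout coefficient `u` inverts `B` modulo p, so the digit congruent to `a` `u` makes `a`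
  -- minus `B` times the digit a multiple of p.
  divideDigit : ∀ {B} → ¬ p ∣ B → ∀ a → ∃[ c ] ∃[ a′ ] a ≡ + B ℤ.* + toℕ {p} c ℤ.+ a′ ℤ.* + p
  divideDigit {B} p∤B a with u , v , uB+vp≡1 ← bézout p∤B =
    fromℕ< r<p , t ℤ.* + B ℤ.+ a ℤ.* v , (begin
      a                                                          ≡⟨ ℤ.*-identityʳ a ⟨
      a ℤ.* + 1                                                  ≡⟨ cong (a ℤ.*_) uB+vp≡1 ⟨
      a ℤ.* (u ℤ.* + B ℤ.+ v ℤ.* + p)                            ≡⟨ ℤS.solve 5 (λ a u B v p → a ℤS.:* (u ℤS.:* B ℤS.:+ v ℤS.:* p) ℤS.:= B ℤS.:* (a ℤS.:* u) ℤS.:+ a ℤS.:* v ℤS.:* p) refl a u (+ B) v (+ p) ⟩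
      + B ℤ.* (a ℤ.* u) ℤ.+ a ℤ.* v ℤ.* + p                      ≡⟨ cong (λ k → + B ℤ.* k ℤ.+ a ℤ.* v ℤ.* + p) (ℤ.a≡a%ℕn+[a/ℕn]*n (a ℤ.* u) p) ⟩
      + B ℤ.* (+ r ℤ.+ t ℤ.* + p) ℤ.+ a ℤ.* v ℤ.* + p            ≡⟨ ℤS.solve 5 (λ B r t p av → B ℤS.:* (r ℤS.:+ t ℤS.:* p) ℤS.:+ av ℤS.:* p ℤS.:= B ℤS.:* r ℤS.:+ (t ℤS.:* B ℤS.:+ av) ℤS.:* p) refl (+ B) (+ r) t (+ p) (a ℤ.* v) ⟩
      + B ℤ.* + r ℤ.+ (t ℤ.* + B ℤ.+ a ℤ.* v) ℤ.* + p            ≡⟨ cong (λ k → + B ℤ.* + k ℤ.+ (t ℤ.* + B ℤ.+ a ℤ.* v) ℤ.* + p) (Fin.toℕ-fromℕ< r<p) ⟨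
      + B ℤ.* + toℕ (fromℕ< r<p) ℤ.+ (t ℤ.* + B ℤ.+ a ℤ.* v) ℤ.* + p ∎)
    where
    open ≡-Reasoning
    r = (a ℤ.* u) ℤ.%ℕ p
    t = (a ℤ.* u) ℤ./ℕ p
    r<p = ℤ.n%ℕd<d (a ℤ.* u) p

  module FractionExpansion {q B} (f : Fraction q B) where
    open Fraction f

    -- Long division of `A` by `B` from the lowest digit upward: subtract `B` times the digit, then
    -- divide by p.
    remainder : ℕ → ℤ
    remainder zero    = A
    remainder (suc n) = proj₁ (proj₂ (divideDigit p∤B (remainder n)))

    digitℕ : ℕ → Fin p
    digitℕ n = proj₁ (divideDigit p∤B (remainder n))

    term : ℕ → ℚ
    term n = ⌜ + toℕ (digitℕ n) ⌝ * P n

    remainder-step : ∀ n → ⌜ remainder n ⌝ ≡ ⌜ + B ⌝ * ⌜ + toℕ (digitℕ n) ⌝ + ⌜ remainder (suc n) ⌝ * ⌜ + p ⌝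
    remainder-step n = trans (cong ⌜_⌝ (proj₂ (proj₂ (divideDigit p∤B (remainder n)))))
      (trans (⌜⌝-+ (+ B ℤ.* + toℕ (digitℕ n)) (remainder (suc n) ℤ.* + p))
        (cong₂ _+_ (⌜⌝-* (+ B) (+ toℕ (digitℕ n))) (⌜⌝-* (remainder (suc n)) (+ p))))

    A≡∑ : ∀ n → ⌜ A ⌝ ≡ ⌜ + B ⌝ * ∑< n term + ⌜ remainder n ⌝ * P n
    A≡∑ zero    = sym (trans (cong₂ _+_ (*-zeroʳ ⌜ + B ⌝) (*-identityʳ ⌜ A ⌝)) (+-identityˡ ⌜ A ⌝))
    A≡∑ (suc n) = begin
      ⌜ A ⌝
        ≡⟨ A≡∑ n ⟩
      ⌜ + B ⌝ * ∑< n term + ⌜ remainder n ⌝ * P n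
        ≡⟨ cong (λ x → ⌜ + B ⌝ * ∑< n term + x * P n) (remainder-step n) ⟩
      ⌜ + B ⌝ * ∑< n term + (⌜ + B ⌝ * c + r′ * ⌜ + p ⌝) * P n
        ≡⟨ solve 6 (λ B s c r p k → B :* s :+ (B :* c :+ r :* p) :* k := B :* (s :+ c :* k) :+ r :* (p :* k))
             refl ⌜ + B ⌝ (∑< n term) c r′ ⌜ + p ⌝ (P n) ⟩
      ⌜ + B ⌝ * ∑< (suc n) term + r′ * (⌜ + p ⌝ * P n)
        ≡⟨ cong (λ x → ⌜ + B ⌝ * ∑< (suc n) term + r′ * x) (⌜⌝-ℕ* p (p ℕ.^ n)) ⟨
      ⌜ + B ⌝ * ∑< (suc n) term + r′ * P (suc n) ∎
      where
      open ≡-Reasoning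
      c  = ⌜ + toℕ (digitℕ n) ⌝
      r′ = ⌜ remainder (suc n) ⌝

    -- The digits of A / B, continued by the digit 0 at negative places; moving them down by `d`
    -- places gives those of `q`.
    shifted : ℤ → Fin p
    shifted (+ n)    = digitℕ n
    shifted -[1+ _ ] = fromℕ< (ℕ.>-nonZero⁻¹ p)

    digit : ℤ → Fin p
    digit n = shifted (n ℤ.+ + d)

    digit-vanishing : ∀ n → n ℤ.< ℤ.- + d → toℕ (digit n) ≡ 0
    digit-vanishing n n<-d
      with n ℤ.+ + d | subst (n ℤ.+ + d ℤ.<_) (ℤ.+-inverseˡ (+ d)) (ℤ.+-monoˡ-< (+ d) n<-d)
    ... | -[1+ _ ] | _ = Fin.toℕ-fromℕ< (ℕ.>-nonZero⁻¹ p)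
    ... | + _      | ℤ.+<+ ()

    partialSum-scaled : ∀ N → partialSum digit d N * P d ≡ ∑< (d ℕ.+ suc N) term
    partialSum-scaled N = ∑<-*ʳ (d ℕ.+ suc N) (P d) λ j → begin
      ⌜ + toℕ (digit (+ j ℤ.- + d)) ⌝ * p^ (+ j ℤ.- + d) * P d
        ≡⟨ *-assoc ⌜ + toℕ (digit (+ j ℤ.- + d)) ⌝ (p^ (+ j ℤ.- + d)) (P d) ⟩
      ⌜ + toℕ (digit (+ j ℤ.- + d)) ⌝ * (p^ (+ j ℤ.- + d) * P d)
        ≡⟨ cong₂ (λ k x → ⌜ + toℕ (shifted k) ⌝ * x)
             (ℤS.solve 2 (λ j d → j ℤS.:- d ℤS.:+ d ℤS.:= j) refl (+ j) (+ d))
             (trans (cong (λ k → p^ k * P d) (ℤ.m-n≡m⊖n j d)) (p^-⊖ j d)) ⟩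
      term j ∎
      where open ≡-Reasoning

    -- A partial sum through p^N consumes `d` + `N` + 1 digits of A / B, so what remains is an
    -- integer times p^(N+1), over `B`. This gives convergence for growing `N`, and at `N` = 0 the
    -- congruence of `q` and its floor modulo p.
    tail : ∀ N → (q - partialSum digit d N) * ⌜ + B ⌝ ≡ ⌜ remainder (d ℕ.+ suc N) ⌝ * P (suc N)
    tail N = *-cancelʳ-⌜⌝ (p ℕ.^ d) {{p^≢0 d}} (begin
      (q - partialSum digit d N) * ⌜ + B ⌝ * P d
        ≡⟨ solve 4 (λ q s B k → (q :- s) :* B :* k := q :* (B :* k) :- B :* (s :* k)) refl q (partialSum digit d N) ⌜ + B ⌝ (P d) ⟩
      q * (⌜ + B ⌝ * P d) - ⌜ + B ⌝ * (partialSum digit d N * P d)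
        ≡⟨ cong₂ (λ x y → x - ⌜ + B ⌝ * y) (trans eq (A≡∑ n)) (partialSum-scaled N) ⟩
      ⌜ + B ⌝ * ∑< n term + ⌜ remainder n ⌝ * P n - ⌜ + B ⌝ * ∑< n term
        ≡⟨ cong (λ x → ⌜ + B ⌝ * ∑< n term + ⌜ remainder n ⌝ * x - ⌜ + B ⌝ * ∑< n term) (P-+ d (suc N)) ⟩
      ⌜ + B ⌝ * ∑< n term + ⌜ remainder n ⌝ * (P d * P (suc N)) - ⌜ + B ⌝ * ∑< n term
        ≡⟨ solve 4 (λ y r k l → y :+ r :* (k :* l) :- y := r :* l :* k) refl (⌜ + B ⌝ * ∑< n term) ⌜ remainder n ⌝ (P d) (P (suc N)) ⟩
      ⌜ remainder n ⌝ * P (suc N) * P d ∎)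
      where
      open ≡-Reasoning
      n = d ℕ.+ suc N

    tail-divisible : ∀ k N → k ℕ.≤ N → Divisible k (q - partialSum digit d N)
    tail-divisible k N k≤N = r ℤ.* + (p ℕ.^ (suc N ℕ.∸ k)) , B , p∤B , (begin
      (q - partialSum digit d N) * ⌜ + B ⌝     ≡⟨ tail N ⟩
      ⌜ r ⌝ * P (suc N)                        ≡⟨ cong (λ j → ⌜ r ⌝ * P j) (ℕ.m∸n+n≡m (ℕ.m≤n⇒m≤1+n k≤N)) ⟨
      ⌜ r ⌝ * P (suc N ℕ.∸ k ℕ.+ k)            ≡⟨ cong (⌜ r ⌝ *_) (P-+ (suc N ℕ.∸ k) k) ⟩
      ⌜ r ⌝ * (P (suc N ℕ.∸ k) * P k)          ≡⟨ *-assoc ⌜ r ⌝ (P (suc N ℕ.∸ k)) (P k) ⟨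
      ⌜ r ⌝ * P (suc N ℕ.∸ k) * P k            ≡⟨ cong (_* P k) (⌜⌝-* r (+ (p ℕ.^ (suc N ℕ.∸ k)))) ⟨
      ⌜ r ℤ.* + (p ℕ.^ (suc N ℕ.∸ k)) ⌝ * P k  ∎)
      where
      open ≡-Reasoning
      r = remainder (d ℕ.+ suc N)

    expansion : ∀ {u} → u ≃ (λ _ → q) → Expansion u
    expansion {u} u≃q = record
      { digit     = digit
      ; d         = d
      ; vanishing = digit-vanishing
      ; converges = ≃-trans {u} {λ _ → q} {partialSum digit d} u≃q
          (divisible⇒null {λ n → q - partialSum digit d n} λ k → k , tail-divisible k)
      }

    floor-remainder : (q - partialSum digit d 0) * ⌜ + B ⌝ ≡ ⌜ remainder (d ℕ.+ 1) ⌝ * ⌜ + p ⌝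
    floor-remainder = trans (tail 0) (cong (λ k → ⌜ remainder (d ℕ.+ 1) ⌝ * ⌜ + k ⌝) (ℕ.*-identityʳ p))

-- Remainders of least absolute value.

∣∣-lub-≤ : ∀ {i j} → i ℤ.≤ j → ℤ.- i ℤ.≤ j → + ℤ.∣ i ∣ ℤ.≤ j
∣∣-lub-≤ {+ _}       i≤j _    = i≤j
∣∣-lub-≤ { -[1+ _ ]} _   -i≤j = -i≤j

∣∣-lub-< : ∀ {i j} → i ℤ.< j → ℤ.- i ℤ.< j → + ℤ.∣ i ∣ ℤ.< j
∣∣-lub-< {+ _}       i<j _    = i<j
∣∣-lub-< { -[1+ _ ]} _   -i<j = -i<j

i≤+∣i∣ : ∀ i → i ℤ.≤ + ℤ.∣ i ∣
i≤+∣i∣ (+ _)    = ℤ.≤-refl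
i≤+∣i∣ -[1+ _ ] = ℤ.-≤+

-- Ties between the remainders ± B / 2 go to the positive one, which belongs to
-- the smaller quotient.
Central : ℕ → ℤ → Set
Central B R = ℤ.- (+ B) ℤ.< R ℤ.+ R × R ℤ.+ R ℤ.≤ + B

-- Doubling avoids halves: dividing `X` = B - 2T by 2B leaves 0 ≤ `r` < 2B, and the quotient `k`
-- taken negatively gives 2R = B - `r`. The reflection makes the interval closed at `B` and open at
-- -B.
centralRemainder : ∀ T B .{{_ : ℕ.NonZero B}} → ∃[ m ] Central B (T ℤ.- m ℤ.* + B)
centralRemainder T B@(suc _) = ℤ.- k ,
  subst (ℤ.- (+ B) ℤ.<_) (sym 2R≡) -B<B-r ,
  subst (ℤ._≤ + B) (sym 2R≡) (ℤ.i≤j⇒i-k≤j {+ B} (+ r) ℤ.≤-refl)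
  where
  X = + B ℤ.- (T ℤ.+ T)
  k = X ℤ./ℕ (B ℕ.+ B)
  r = X ℤ.%ℕ (B ℕ.+ B)
  2R≡ : (T ℤ.- (ℤ.- k) ℤ.* + B) ℤ.+ (T ℤ.- (ℤ.- k) ℤ.* + B) ≡ + B ℤ.- + r
  2R≡ = begin
    (T ℤ.- (ℤ.- k) ℤ.* + B) ℤ.+ (T ℤ.- (ℤ.- k) ℤ.* + B)
      ≡⟨ ℤS.solve 3 (λ T k B → (T ℤS.:- (ℤS.:- k) ℤS.:* B) ℤS.:+ (T ℤS.:- (ℤS.:- k) ℤS.:* B)
           ℤS.:= B ℤS.:- (B ℤS.:- (T ℤS.:+ T)) ℤS.:+ k ℤS.:* (B ℤS.:+ B)) refl T k (+ B) ⟩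
    + B ℤ.- X ℤ.+ k ℤ.* (+ B ℤ.+ + B)
      ≡⟨ cong (λ x → + B ℤ.- x ℤ.+ k ℤ.* (+ B ℤ.+ + B)) (ℤ.a≡a%ℕn+[a/ℕn]*n X (B ℕ.+ B)) ⟩
    + B ℤ.- (+ r ℤ.+ k ℤ.* (+ B ℤ.+ + B)) ℤ.+ k ℤ.* (+ B ℤ.+ + B)
      ≡⟨ ℤS.solve 3 (λ r y B → B ℤS.:- (r ℤS.:+ y) ℤS.:+ y ℤS.:= B ℤS.:- r) refl (+ r) (k ℤ.* (+ B ℤ.+ + B)) (+ B) ⟩
    + B ℤ.- + r ∎
    where open ≡-Reasoning
  -B<B-r : ℤ.- (+ B) ℤ.< + B ℤ.- + r
  -B<B-r = subst (ℤ._< + B ℤ.- + r)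
    (ℤS.solve 1 (λ B → B ℤS.:- (B ℤS.:+ B) ℤS.:= ℤS.:- B) refl (+ B))
    (ℤ.+-monoʳ-< (+ B) (ℤ.neg-mono-< (ℤ.+<+ (ℤ.n%ℕd<d X (B ℕ.+ B)))))

module _ {T m B} (central : Central B (T ℤ.- m ℤ.* + B)) where
  private
    R : ℤ
    R = T ℤ.- m ℤ.* + B

    -- By this much T - jB lies beyond R ± B.
    gap : ∀ {i j} → i ℤ.< j → + 0 ℤ.≤ (j ℤ.- ℤ.suc i) ℤ.* + B
    gap {i} {j} i<j = ℤ.*-monoʳ-≤-nonNeg (+ B) {+ 0} (ℤ.i≤j⇒0≤j-i (ℤ.i<j⇒suc[i]≤j i<j))

  -- Here T - jB is at least R + B, and -B < 2R together with 0 < B gives ∣R∣ < R + B. The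
  -- strictness is what later makes `m` the least minimizer.
  central-minimal-< : ∀ j → j ℤ.< m → ℤ.∣ R ∣ ℕ.< ℤ.∣ T ℤ.- j ℤ.* + B ∣
  central-minimal-< j j<m = ℤ.drop‿+<+ (ℤ.<-≤-trans
    (∣∣-lub-< {R} {R ℤ.+ + B} R<R+B -R<R+B) (ℤ.≤-trans R+B≤ (i≤+∣i∣ (T ℤ.- j ℤ.* + B))))
    where
    R+B≤ : R ℤ.+ + B ℤ.≤ T ℤ.- j ℤ.* + B
    R+B≤ = ℤ.0≤i-j⇒j≤i (subst (+ 0 ℤ.≤_)
      (ℤS.solve 4 (λ m j T B → (m ℤS.:- (ℤS.con (+ 1) ℤS.:+ j)) ℤS.:* B
        ℤS.:= (T ℤS.:- j ℤS.:* B) ℤS.:- (T ℤS.:- m ℤS.:* B ℤS.:+ B)) refl m j T (+ B)) (gap j<m))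
    -R<R+B : ℤ.- R ℤ.< R ℤ.+ + B
    -R<R+B = subst₂ ℤ._<_
      (ℤS.solve 2 (λ r B → (ℤS.:- B) ℤS.:+ (B ℤS.:- r) ℤS.:= ℤS.:- r) refl R (+ B))
      (ℤS.solve 2 (λ r B → (r ℤS.:+ r) ℤS.:+ (B ℤS.:- r) ℤS.:= r ℤS.:+ B) refl R (+ B))
      (ℤ.+-monoˡ-< (+ B ℤ.- R) (proj₁ central))
    0<B : + 0 ℤ.< + B
    0<B = ℤ.≰⇒> λ B≤0 → ℤ.<⇒≱ (proj₁ central) (ℤ.≤-trans (proj₂ central) (ℤ.≤-trans B≤0 (ℤ.neg-mono-≤ B≤0)))
    R<R+B : R ℤ.< R ℤ.+ + B
    R<R+B = subst (ℤ._< R ℤ.+ + B) (ℤ.+-identityʳ R) (ℤ.+-monoʳ-< R 0<B)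

  -- Now jB - T is at least B - R, which bounds ∣R∣ because 2R ≤ B. Equality can occur when 2R = B,
  -- which is harmless for a larger `j`.
  central-minimal-> : ∀ j → m ℤ.< j → ℤ.∣ R ∣ ℕ.≤ ℤ.∣ T ℤ.- j ℤ.* + B ∣
  central-minimal-> j m<j = ℤ.drop‿+≤+ (ℤ.≤-trans
    (∣∣-lub-≤ {R} {+ B ℤ.- R} R≤B-R -R≤B-R)
    (ℤ.≤-trans B-R≤ (subst (λ n → ℤ.- Y ℤ.≤ + n) (ℤ.∣-i∣≡∣i∣ Y) (i≤+∣i∣ (ℤ.- Y)))))
    where
    Y = T ℤ.- j ℤ.* + B
    B-R≤ : + B ℤ.- R ℤ.≤ ℤ.- Y
    B-R≤ = ℤ.0≤i-j⇒j≤i (subst (+ 0 ℤ.≤_)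
      (ℤS.solve 4 (λ m j T B → (j ℤS.:- (ℤS.con (+ 1) ℤS.:+ m)) ℤS.:* B
        ℤS.:= (ℤS.:- (T ℤS.:- j ℤS.:* B)) ℤS.:- (B ℤS.:- (T ℤS.:- m ℤS.:* B))) refl m j T (+ B)) (gap m<j))
    R≤B-R : R ℤ.≤ + B ℤ.- R
    R≤B-R = subst (ℤ._≤ + B ℤ.- R)
      (ℤS.solve 1 (λ r → (r ℤS.:+ r) ℤS.:- r ℤS.:= r) refl R)
      (ℤ.+-monoˡ-≤ (ℤ.- R) (proj₂ central))
    -R≤B-R : ℤ.- R ℤ.≤ + B ℤ.- R
    -R≤B-R = subst (ℤ._≤ + B ℤ.- R) (ℤ.+-identityˡ (ℤ.- R)) (ℤ.+-monoˡ-≤ (ℤ.- R) {+ 0} (ℤ.+≤+ ℕ.z≤n))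

  central-minimal : ∀ j → ℤ.∣ R ∣ ℕ.≤ ℤ.∣ T ℤ.- j ℤ.* + B ∣
  central-minimal j with ℤ.<-cmp j m
  ... | tri< j<m _ _ = ℕ.<⇒≤ (central-minimal-< j j<m)
  ... | tri≈ _ refl _ = ℕ.≤-refl
  ... | tri> _ _ m<j = central-minimal-> j m<j

  central-half : ℤ.∣ R ∣ ℕ.+ ℤ.∣ R ∣ ℕ.≤ B
  central-half = half R central
    where
    half : ∀ r → Central B r → ℤ.∣ r ∣ ℕ.+ ℤ.∣ r ∣ ℕ.≤ B
    half (+ n)    (_ , 2r≤B) = ℤ.drop‿+≤+ 2r≤B
    half -[1+ n ] (-B<2r , _) = ℤ.drop‿+≤+ (subst₂ ℤ._≤_
      (cong +_ (cong suc (sym (ℕ.+-suc n n)))) (ℤ.neg-involutive (+ B)) (ℤ.neg-mono-≤ (ℤ.<⇒≤ -B<2r)))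

-- Comparing real distances through their rational limits.

module RealLimit {u : Seq} {q : ℚ} (u≃q : Completion._≃_ ∣_∣ u (λ _ → q)) where

  dist : ℚ → Seq
  dist b n = ∣ u n - b ∣

  private
    dist-upper : ∀ n b → ∣ u n - b ∣ ≤ ∣ q - b ∣ + ∣ u n - q ∣
    dist-upper n b = subst (λ x → ∣ x ∣ ≤ ∣ q - b ∣ + ∣ u n - q ∣)
      (solve 3 (λ q b x → (q :- b) :+ (x :- q) := x :- b) refl q b (u n)) (∣p+q∣≤∣p∣+∣q∣ (q - b) (u n - q))

    dist-lower : ∀ n b → ∣ q - b ∣ ≤ ∣ u n - b ∣ + ∣ u n - q ∣
    dist-lower n b = subst (λ x → ∣ x ∣ ≤ ∣ u n - b ∣ + ∣ u n - q ∣)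
      (solve 3 (λ q b x → (x :- b) :- (x :- q) := q :- b) refl q b (u n)) (∣p-q∣≤∣p∣+∣q∣ (u n - b) (u n - q))

  -- Together with `dist-cancel` this turns `Minimizer` at `ι q` into a comparison of rational
  -- numbers.
  dist-mono : ∀ {b c} → ∣ q - b ∣ ≤ ∣ q - c ∣ → dist b ≤ᴿ dist c
  dist-mono {b} {c} b≤c ε ε>0 with N , close ← u≃q (ε * ½) (halve ε>0) = N , λ n N≤n → begin
    ∣ u n - b ∣                                    ≤⟨ dist-upper n b ⟩
    ∣ q - b ∣ + ∣ u n - q ∣                        ≤⟨ +-mono-≤ (≤-trans b≤c (dist-lower n c)) (<⇒≤ (close n N≤n)) ⟩
    ∣ u n - c ∣ + ∣ u n - q ∣ + ε * ½              ≤⟨ +-monoˡ-≤ (ε * ½) (+-monoʳ-≤ ∣ u n - c ∣ (<⇒≤ (close n N≤n))) ⟩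
    ∣ u n - c ∣ + ε * ½ + ε * ½                    ≡⟨ +-assoc ∣ u n - c ∣ (ε * ½) (ε * ½) ⟩
    ∣ u n - c ∣ + (ε * ½ + ε * ½)                  ≡⟨ cong (_+_ ∣ u n - c ∣) (halves ε) ⟩
    ∣ u n - c ∣ + ε                                ∎
    where open ≤-Reasoning

  dist-cancel : ∀ {b c} → dist b ≤ᴿ dist c → ∣ q - b ∣ ≤ ∣ q - c ∣
  dist-cancel {b} {c} b≤c = ≮⇒≥ λ c<b →
    let δ   = ∣ q - b ∣ - ∣ q - c ∣
        δ>0 = subst (_< δ) (+-inverseʳ ∣ q - c ∣) (+-monoˡ-< (- ∣ q - c ∣) c<b)
        -- Replacing `q` by `u n` costs `η` on each of the two sides, and `b≤c` has slack `δ * ½`;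
        -- together they exhaust the gap `δ`.
        η   = δ * ½ * ½
        η>0 = halve (halve δ>0)
        N , close = u≃q η η>0
        M , below = b≤c (δ * ½) (halve δ>0)
        n   = N ℕ.⊔ M
        near = close n (ℕ.m≤m⊔n N M)
    in <-irrefl refl (begin-strict
      ∣ q - b ∣                                               ≤⟨ dist-lower n b ⟩
      ∣ u n - b ∣ + ∣ u n - q ∣                               <⟨ +-mono-≤-< (≤-trans (below n (ℕ.m≤n⊔m N M)) (+-monoˡ-≤ (δ * ½) (dist-upper n c))) near ⟩
      ∣ q - c ∣ + ∣ u n - q ∣ + δ * ½ + η                     <⟨ +-monoˡ-< η (+-monoˡ-< (δ * ½) (+-monoʳ-< ∣ q - c ∣ near)) ⟩
      ∣ q - c ∣ + η + δ * ½ + η                               ≡⟨ solve 3 (λ c η h → c :+ η :+ h :+ η := c :+ ((η :+ η) :+ h)) refl ∣ q - c ∣ η (δ * ½) ⟩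
      ∣ q - c ∣ + (η + η + δ * ½)                             ≡⟨ cong (λ x → ∣ q - c ∣ + (x + δ * ½)) (halves (δ * ½)) ⟩
      ∣ q - c ∣ + (δ * ½ + δ * ½)                             ≡⟨ cong (_+_ ∣ q - c ∣) (halves δ) ⟩
      ∣ q - c ∣ + δ                                           ≡⟨ solve 2 (λ c b → c :+ (b :- c) := b) refl ∣ q - c ∣ ∣ q - b ∣ ⟩
      ∣ q - b ∣                                               ∎)
    where open ≤-Reasoning

-- One step of the algorithm, and the descent.

module Halting {c ℓ₁ ℓ₂} (p : ℕ) (p-prime : Prime p) (K : HeytingField c ℓ₁ ℓ₂)
  (σ∞ : Embedding K ∣_∣) (σₚ : Embedding K (PAdic.∣_∣ₚ p p-prime))
  (ι : ℚ → HeytingField.Carrier K)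
  (ι-hom : IsRingHomomorphism +-*-rawRing (CommutativeRing.rawRing (ringOf K)) ι)
  where

  open PAdic p p-prime using (module Expansion; partialSum)
  open PAdicProperties p p-prime
  open Algorithm p p-prime K σ∞ σₚ ι
  open CommutativeRing (ringOf K) using (Carrier; _≈_; 1#) renaming (_*_ to _*ᴷ_; _-_ to _-ᴷ_)
  private
    module K = CommutativeRing (ringOf K)
    module ι = IsRingHomomorphism ι-hom
    module σ∞ = Embedding σ∞
    module σₚ = Embedding σₚ
    module ℝ = NullIdeal ∣_∣ (λ {u} {v} → ∣∣-null-+ {u} {v}) (λ x {u} → ∣∣-null-* x {u})

  σ∞-ι : ∀ q → Completion._≃_ ∣_∣ σ∞.⟦ ι q ⟧ (λ _ → q)
  σ∞-ι = ℝ.Constant.const (Composition.isRingHomomorphism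
    (λ {u} {v} {w} → ℝ.≃-trans {u} {v} {w}) ι-hom
    (IsRingMonomorphism.isRingHomomorphism σ∞.isRingMonomorphism))

  σₚ-ι : ∀ q → PAdic._≃_ p p-prime σₚ.⟦ ι q ⟧ (λ _ → q)
  σₚ-ι = Constant.const (Composition.isRingHomomorphism
    (λ {u} {v} {w} → ≃-trans {u} {v} {w}) ι-hom
    (IsRingMonomorphism.isRingHomomorphism σₚ.isRingMonomorphism))

  -- The spacing as a power of p, so that it can be absorbed into the p-part of the next
  -- denominator.
  exponent : Parity → ℕ
  exponent 0ℙ = 1
  exponent 1ℙ = 0

  ⌜scale⌝ : ∀ ε → ⌜ scale ε ⌝ ≡ P (exponent ε)
  ⌜scale⌝ 0ℙ = cong (λ n → ⌜ + n ⌝) (sym (ℕ.*-identityʳ p))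
  ⌜scale⌝ 1ℙ = refl

  scale-pos : ∀ ε → Positive ⌜ scale ε ⌝
  scale-pos ε = subst Positive (sym (⌜scale⌝ ε)) (P-pos (exponent ε))

  ι-inverse : ∀ {q r b} → r * (q - b) ≡ 1ℚ → ι r *ᴷ (ι q -ᴷ ι b) ≈ 1#
  ι-inverse {q} {r} {b} eq = begin
    ι r *ᴷ (ι q -ᴷ ι b)       ≈⟨ K.*-congˡ (K.+-congˡ (ι.-‿homo b)) ⟨
    ι r *ᴷ (ι q K.+ ι (- b))  ≈⟨ K.*-congˡ (ι.+-homo q (- b)) ⟨
    ι r *ᴷ ι (q - b)          ≈⟨ ι.*-homo r (q - b) ⟨
    ι (r * (q - b))           ≡⟨ cong ι eq ⟩
    ι 1ℚ                      ≈⟨ ι.1#-homo ⟩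
    1#                        ∎
    where open import Relation.Binary.Reasoning.Setoid K.setoid

  -- The error of the floor is p r / B with r an integer. Spacing p takes out the factor p and
  -- leaves `T` = r; spacing 1 leaves it inside, as `T` = r p.
  scaledFloor : ∀ ε {q B} (f : Fraction q B) →
    ∃[ e ] ∃[ T ] (q - Expansion.floor {σₚ.⟦ ι q ⟧} e) * ⌜ + B ⌝ ≡ ⌜ scale ε ⌝ * ⌜ T ⌝
  scaledFloor ε {q} {B} f = expansion (σₚ-ι q) , scaled ε
    where
    open FractionExpansion f
    r = remainder (Fraction.d f ℕ.+ 1)
    scaled : ∀ ε → ∃[ T ] (q - partialSum digit (Fraction.d f) 0) * ⌜ + B ⌝ ≡ ⌜ scale ε ⌝ * ⌜ T ⌝
    scaled 0ℙ = r , trans floor-remainder (*-comm ⌜ r ⌝ ⌜ + p ⌝)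
    scaled 1ℙ = r ℤ.* + p , trans floor-remainder (trans (sym (⌜⌝-* r (+ p))) (sym (*-identityˡ ⌜ r ℤ.* + p ⌝)))

  module Step (ε : Parity) {q B} (p∤B : ¬ p ∣ B) (e : PAdic.Expansion p p-prime σₚ.⟦ ι q ⟧)
    (T : ℤ) (scaled : (q - Expansion.floor e) * ⌜ + B ⌝ ≡ ⌜ scale ε ⌝ * ⌜ T ⌝)
    (m : ℤ) (central : Central B (T ℤ.- m ℤ.* + B))
    where

    R : ℤ
    R = T ℤ.- m ℤ.* + B

    private
      s : ℚ
      s = ⌜ scale ε ⌝

      ⌊q⌋ : ℚ
      ⌊q⌋ = Expansion.floor e

    -- Finding the candidate nearest to `q` thereby becomes finding the multiple of `B` nearest to
    -- `T`.
    offset : ∀ i → (q - candidate ε ⌊q⌋ i) * ⌜ + B ⌝ ≡ s * ⌜ T ℤ.- i ℤ.* + B ⌝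
    offset i = begin
      (q - (⌜ i ℤ.* scale ε ⌝ + ⌊q⌋)) * ⌜ + B ⌝
        ≡⟨ cong (λ x → (q - (x + ⌊q⌋)) * ⌜ + B ⌝) (⌜⌝-* i (scale ε)) ⟩
      (q - (⌜ i ⌝ * s + ⌊q⌋)) * ⌜ + B ⌝
        ≡⟨ solve 5 (λ q i s f B → (q :- (i :* s :+ f)) :* B := (q :- f) :* B :- s :* (i :* B)) refl q ⌜ i ⌝ s ⌊q⌋ ⌜ + B ⌝ ⟩
      (q - ⌊q⌋) * ⌜ + B ⌝ - s * (⌜ i ⌝ * ⌜ + B ⌝)
        ≡⟨ cong (_- s * (⌜ i ⌝ * ⌜ + B ⌝)) scaled ⟩
      s * ⌜ T ⌝ - s * (⌜ i ⌝ * ⌜ + B ⌝)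
        ≡⟨ solve 3 (λ s t x → s :* t :- s :* x := s :* (t :- x)) refl s ⌜ T ⌝ (⌜ i ⌝ * ⌜ + B ⌝) ⟩
      s * (⌜ T ⌝ - ⌜ i ⌝ * ⌜ + B ⌝)
        ≡⟨ cong (s *_) (trans (⌜⌝-- T (i ℤ.* + B)) (cong (λ x → ⌜ T ⌝ - x) (⌜⌝-* i (+ B)))) ⟨
      s * ⌜ T ℤ.- i ℤ.* + B ⌝ ∎
      where open ≡-Reasoning

    ∣offset∣ : ∀ i → ∣ q - candidate ε ⌊q⌋ i ∣ * ⌜ + B ⌝ ≡ s * ⌜ + ℤ.∣ T ℤ.- i ℤ.* + B ∣ ⌝
    ∣offset∣ i = begin
      ∣ x ∣ * ⌜ + B ⌝                        ≡⟨ cong (∣ x ∣ *_) (⌜⌝-∣∣ (+ B)) ⟨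
      ∣ x ∣ * ∣ ⌜ + B ⌝ ∣                    ≡⟨ ∣p*q∣≡∣p∣*∣q∣ x ⌜ + B ⌝ ⟨
      ∣ x * ⌜ + B ⌝ ∣                        ≡⟨ cong ∣_∣ (offset i) ⟩
      ∣ s * ⌜ T ℤ.- i ℤ.* + B ⌝ ∣            ≡⟨ ∣p*q∣≡∣p∣*∣q∣ s ⌜ T ℤ.- i ℤ.* + B ⌝ ⟩
      ∣ s ∣ * ∣ ⌜ T ℤ.- i ℤ.* + B ⌝ ∣        ≡⟨ cong₂ _*_ (0≤p⇒∣p∣≡p (<⇒≤ (positive⁻¹ s {{scale-pos ε}}))) (⌜⌝-∣∣ (T ℤ.- i ℤ.* + B)) ⟩
      s * ⌜ + ℤ.∣ T ℤ.- i ℤ.* + B ∣ ⌝        ∎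
      where
      open ≡-Reasoning
      x = q - candidate ε ⌊q⌋ i

    private instance
      B-nonZero : ℕ.NonZero B
      B-nonZero = p∤⇒nonZero p∤B

    b : ℚ
    b = candidate ε ⌊q⌋ m

    closest : ∀ j → ∣ q - b ∣ ≤ ∣ q - candidate ε ⌊q⌋ j ∣
    closest j = *-cancelʳ-≤-pos ⌜ + B ⌝ {{⌜⌝-pos B}} (subst₂ _≤_ (sym (∣offset∣ m)) (sym (∣offset∣ j))
      (*-monoˡ-≤-nonNeg s {{pos⇒nonNeg s {{scale-pos ε}}}}
        (⌜⌝-mono-≤ (ℤ.+≤+ (central-minimal {T} {m} central j)))))

    strictly-closer : ∀ j → j ℤ.< m → ∣ q - b ∣ < ∣ q - candidate ε ⌊q⌋ j ∣
    strictly-closer j j<m = *-cancelʳ-<-nonNeg ⌜ + B ⌝ {{pos⇒nonNeg ⌜ + B ⌝ {{⌜⌝-pos B}}}}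
      (subst₂ _<_ (sym (∣offset∣ m)) (sym (∣offset∣ j))
        (*-monoʳ-<-pos s {{scale-pos ε}} (⌜⌝-mono-< (ℤ.+<+ (central-minimal-< {T} {m} central j j<m)))))

    leastMinimizer : LeastMinimizer ε (ι q) ⌊q⌋ m
    leastMinimizer =
      (λ j → dist-mono (closest j)) ,
      λ j j-min → ℤ.≮⇒≥ λ j<m → <-irrefl refl (<-≤-trans (strictly-closer j j<m) (dist-cancel (j-min m)))
      where open RealLimit {σ∞.⟦ ι q ⟧} {q} (σ∞-ι q)

    ↦b : ε [ ι q ]↦b b
    ↦b = e , m , leastMinimizer , refl

    R≡0⇒q≡b : R ≡ + 0 → q ≡ b
    R≡0⇒q≡b R≡0 = begin
      q              ≡⟨ solve 2 (λ q b → q := (q :- b) :+ b) refl q b ⟩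
      (q - b) + b    ≡⟨ cong (_+ b) q-b≡0 ⟩
      0ℚ + b         ≡⟨ +-identityˡ b ⟩
      b              ∎
      where
      open ≡-Reasoning
      q-b≡0 : q - b ≡ 0ℚ
      q-b≡0 = *-cancelʳ-⌜⌝ B (trans (offset m) (trans (cong (λ r → s * ⌜ r ⌝) R≡0)
        (trans (*-zeroʳ s) (sym (*-zeroˡ ⌜ + B ⌝)))))

    module _ (R≢0 : R ≢ + 0) where
      private instance
        ∣R∣-nonZero : ℕ.NonZero ℤ.∣ R ∣
        ∣R∣-nonZero = ℕ.≢-nonZero λ ∣R∣≡0 → R≢0 (ℤ.∣i∣≡0⇒i≡0 ∣R∣≡0)

        q-b-nonZero : NonZero (q - b)
        q-b-nonZero = ≢-nonZero {q - b} λ q-b≡0 → R≢0 (⌜⌝-injective (*-cancelˡ-zero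
          (trans (sym (offset m)) (trans (cong (_* ⌜ + B ⌝) q-b≡0) (*-zeroˡ ⌜ + B ⌝)))))
          where
          *-cancelˡ-zero : ∀ {x} → s * x ≡ 0ℚ → x ≡ 0ℚ
          *-cancelˡ-zero {x} sx≡0 = ≤-antisym
            (*-cancelˡ-≤-pos s {{scale-pos ε}} (≤-reflexive (trans sx≡0 (sym (*-zeroʳ s)))))
            (*-cancelˡ-≤-pos s {{scale-pos ε}} (≤-reflexive (trans (*-zeroʳ s) (sym sx≡0))))

      next : ℚ
      next = 1/ (q - b)

      ↦F : ε [ ι q ]↦F ι next
      ↦F = b , ↦b , ι-inverse (*-inverseˡ (q - b))

      next-equation : next * (⌜ R ⌝ * s) ≡ ⌜ + B ⌝
      next-equation = begin
        next * (⌜ R ⌝ * s)              ≡⟨ cong (next *_) (trans (*-comm ⌜ R ⌝ s) (sym (offset m))) ⟩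
        next * ((q - b) * ⌜ + B ⌝)      ≡⟨ *-assoc next (q - b) ⌜ + B ⌝ ⟨
        next * (q - b) * ⌜ + B ⌝        ≡⟨ cong (_* ⌜ + B ⌝) (*-inverseˡ (q - b)) ⟩
        1ℚ * ⌜ + B ⌝                    ≡⟨ *-identityˡ ⌜ + B ⌝ ⟩
        ⌜ + B ⌝                         ∎
        where open ≡-Reasoning

      -- A `Fraction` has a natural number below the line, so the sign of `R` moves to the
      -- numerator.
      numerator-next : ∃[ A ] next * (⌜ + ℤ.∣ R ∣ ⌝ * s) ≡ ⌜ A ⌝
      numerator-next = signed R next-equation
        where
        signed : ∀ r → next * (⌜ r ⌝ * s) ≡ ⌜ + B ⌝ → ∃[ A ] next * (⌜ + ℤ.∣ r ∣ ⌝ * s) ≡ ⌜ A ⌝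
        signed (+ _)      eq = + B , eq
        signed r@(-[1+ _ ]) eq = ℤ.- (+ B) , (begin
          next * (⌜ ℤ.- r ⌝ * s)     ≡⟨ cong (λ x → next * (x * s)) (⌜⌝-neg r) ⟩
          next * (- ⌜ r ⌝ * s)       ≡⟨ solve 3 (λ n r s → n :* ((:- r) :* s) := :- (n :* (r :* s))) refl next ⌜ r ⌝ s ⟩
          - (next * (⌜ r ⌝ * s))     ≡⟨ cong -_ eq ⟩
          - ⌜ + B ⌝                  ≡⟨ ⌜⌝-neg (+ B) ⟨
          ⌜ ℤ.- (+ B) ⌝              ∎)
          where open ≡-Reasoning

      next-fraction : ∃[ B′ ] B′ ℕ.< B × Fraction next B′
      next-fraction = B′ , B′<B , record
        { A   = proj₁ numerator-next
        -- The factors p of `R` and of the spacing go together into the power of p, leaving `B′`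
        -- prime to p.
        ; d   = k ℕ.+ exponent ε
        ; p∤B = proj₁ (proj₂ ∣R∣-spec)
        ; eq  = trans (cong (next *_) denominator) (proj₂ numerator-next)
        }
        where
        ∣R∣-spec = multiplicity-spec p ℤ.∣ R ∣
        k = multiplicity p ℤ.∣ R ∣
        B′ = proj₁ ∣R∣-spec
        ∣R∣≡ = proj₂ (proj₂ ∣R∣-spec)
        denominator : ⌜ + B′ ⌝ * P (k ℕ.+ exponent ε) ≡ ⌜ + ℤ.∣ R ∣ ⌝ * s
        denominator = begin
          ⌜ + B′ ⌝ * P (k ℕ.+ exponent ε)        ≡⟨ cong (⌜ + B′ ⌝ *_) (P-+ k (exponent ε)) ⟩
          ⌜ + B′ ⌝ * (P k * P (exponent ε))      ≡⟨ *-assoc ⌜ + B′ ⌝ (P k) (P (exponent ε)) ⟨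
          ⌜ + B′ ⌝ * P k * P (exponent ε)        ≡⟨ cong₂ _*_ (trans (sym (⌜⌝-ℕ* B′ (p ℕ.^ k))) (cong (λ n → ⌜ + n ⌝) (sym ∣R∣≡))) (sym (⌜scale⌝ ε)) ⟩
          ⌜ + ℤ.∣ R ∣ ⌝ * s                      ∎
          where open ≡-Reasoning
        B′<B : B′ ℕ.< B
        B′<B = begin-strict
          B′                       ≤⟨ ℕ.m≤m*n B′ (p ℕ.^ k) {{p^≢0 k}} ⟩
          B′ ℕ.* p ℕ.^ k           ≡⟨ ∣R∣≡ ⟨
          ℤ.∣ R ∣                  <⟨ ℕ.m<m+n ℤ.∣ R ∣ (ℕ.>-nonZero⁻¹ ℤ.∣ R ∣) ⟩
          ℤ.∣ R ∣ ℕ.+ ℤ.∣ R ∣      ≤⟨ central-half {T} {m} central ⟩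
          B                        ∎
          where open ℕ.≤-Reasoning

  Advance : Carrier → ℕ → ℕ → Set (c ⊔ ℓ₁)
  Advance α n B = Halts α ⊎ (∃[ r ] ∃[ B′ ] B′ ℕ.< B × Fraction r B′ × Term α (suc n) (ι r))

  advance : ∀ {α B q n} → Fraction q B → Term α n (ι q) → Advance α n B
  -- Halting is decided by an equality of integers, since equality in `K` comes with no decision
  -- procedure.
  advance {α} {B} {q} {n} f term = decide (R ℤ.≟ + 0)
    where
    floor-scaled = scaledFloor (parity n) f
    T = proj₁ (proj₂ floor-scaled)
    rounding = centralRemainder T B {{p∤⇒nonZero (Fraction.p∤B f)}}
    open Step (parity n) (Fraction.p∤B f) (proj₁ floor-scaled) T (proj₂ (proj₂ floor-scaled))
      (proj₁ rounding) (proj₂ rounding)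
    decide : Dec (R ≡ + 0) → Advance α n B
    decide (yes R≡0) = inj₁ (n , ι q , term , b , ↦b , K.reflexive (cong ι (R≡0⇒q≡b R≡0)))
    decide (no R≢0)  = inj₂ (next R≢0 , proj₁ (next-fraction R≢0) , proj₁ (proj₂ (next-fraction R≢0)) ,
      proj₂ (proj₂ (next-fraction R≢0)) , step term (↦F R≢0))

  halts-from : ∀ {α B} → Acc ℕ._<_ B → ∀ {q n} → Fraction q B → Term α n (ι q) → Halts α
  halts-from (acc rs) f term =
    [ id , (λ (_ , _ , B′<B , f′ , term′) → halts-from (rs B′<B) f′ term′) ]′ (advance f term)

theorem2p5 : ∀ {c ℓ₁ ℓ₂} (p : ℕ) (p-prime : Prime p) (K : HeytingField c ℓ₁ ℓ₂)
    (σ∞ : Embedding K ∣_∣) (σₚ : Embedding K (PAdic.∣_∣ₚ p p-prime))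
    (ι : ℚ → HeytingField.Carrier K) →
    IsRingHomomorphism +-*-rawRing (CommutativeRing.rawRing (ringOf K)) ι →
    (α : ℚ) → Algorithm.Halts p p-prime K σ∞ σₚ ι (ι α)
theorem2p5 p p-prime K σ∞ σₚ ι ι-hom α =
  halts-from (<-wellFounded (proj₁ α-fraction)) (proj₂ α-fraction)
    (Algorithm.start (CommutativeRing.refl (ringOf K)))
  where
  open Halting p p-prime K σ∞ σₚ ι ι-hom
  α-fraction = PAdicProperties.fraction p p-prime α
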